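{- Let $k,\ell\ge1$. The matching $M$ on the poset $P(k,\ell)$ is acyclic (a Morse matching), its unmatched elements are exactly the partitions $\lambda\in P(k,\ell)$ in which every nonzero part has even multiplicity and parity opposite to $\ell$ and, if $\ell$ is odd, $0$ has even multiplicity. Moreover, the homology of the complex $(\mathcal{C}(\mathbb{F}_2)^G,D)$ is concentrated in even dimensions.
   Context: $P(k,\ell)$ is the set of partitions $\lambda=(\lambda_1,\dots,\lambda_k)$ with $\ell\ge\lambda_1\ge\cdots\ge\lambda_k\ge0$ (exactly $k$ parts, zeros counted in multiplicities), partially ordered by inclusion of Ferrers diagrams. For $\lambda\in P(k,\ell)$: $A(\lambda)$ is the smallest nonzero part having the same parity as $\ell$ ($\infty$ if none); $B(\lambda)$ is the smallest part value (zero allowed) having odd multiplicity and parity opposite to $\ell$ ($\infty$ if none). If $A(\lambda)<B(\lambda)$, $M(\lambda)$ replaces one part $A(\lambda)$ by $A(\lambda)-1$; if $B(\lambda)<A(\lambda)$, $M(\lambda)$ replaces one part $B(\lambda)$ by $B(\lambda)+1$; if both are $\infty$, $\lambda$ is unmatched. A matching on the Hasse diagram is acyclic if directing all Hasse edges downward and then reversing matched edges yields no directed cycle. The complex: let $B$ be the set of boxes of a $k\times\ell$ rectangle, $G\cong\mathfrak{S}_\ell\wr\mathfrak{S}_k$ the group of permutations of $B$ preserving the partition of $B$ into rows. Let $\mathcal{C}(\mathbb{F}_2)$ be the $\mathbb{F}_2$-space with basis $\{e_S:S\subseteq B\}$ graded by $|S|$, with $G$ permuting the basis, and $D(e_S)=\sum_{x\in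 S}e_{S\setminus\{x\}}$. $\mathcal{C}(\mathbb{F}_2)^G$ is the $G$-invariant subspace, with basis indexed by $G$-orbits of subsets, equivalently by $P(k,\ell)$ (the orbit of subsets whose row-intersection sizes are the parts of $\lambda$), and $(\mathcal{C}(\mathbb{F}_2)^G,D)$ is a chain complex. -}

module Defs where

open import Data.Nat using (ℕ; zero; suc; _+_; _∸_; _≤_; _<ᵇ_; _≡ᵇ_; _%_)
open import Data.Bool using (Bool; true; false; not; _∧_; _∨_; _xor_; if_then_else_)
open import Data.Maybe using (Maybe; just; nothing)
open import Data.List using (List; []; _∷_; foldr; map; concatMap; allFin)
open import Data.Vec using (Vec; []; _∷_; lookup; toList; tabulate; updateAt; _[_]%=_)
open import Data.Fin using (Fin)
import Data.Fin as F
open import Data.Product using (_×_; _,_; proj₁; Σ)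
open import Data.Sum using (_⊎_)
open import Data.Empty using (⊥)
open import Function.Bundles using (_↔_; Inverse)
open import Relation.Binary.PropositionalEquality using (_≡_; _≢_)
open import Relation.Binary.Construct.Closure.Transitive using (TransClosure)

-- The poset P(k,ℓ)
-- A partition la ∈ P(k,ℓ) is a weakly decreasing vector of k naturals, each ≤ ℓ
-- (zeros included as parts).

IsPart : (k ℓ : ℕ) → Vec ℕ k → Set
IsPart k ℓ la = (∀ i → lookup la i ≤ ℓ) × (∀ (i j : Fin k) → i F.≤ j → lookup la j ≤ lookup la i)

_⊑_ : ∀ {k} → Vec ℕ k → Vec ℕ k → Set
μ ⊑ la = ∀ i → lookup μ i ≤ lookup la i

size : ∀ {k} → Vec ℕ k → ℕ
size [] = 0
size (x ∷ xs) = x + size xs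

_⋖_ : ∀ {k} → Vec ℕ k → Vec ℕ k → Set
μ ⋖ la = (μ ⊑ la) × (size la ≡ suc (size μ))

mult : ∀ {k} → ℕ → Vec ℕ k → ℕ
mult p [] = 0
mult p (x ∷ xs) = if x ≡ᵇ p then suc (mult p xs) else mult p xs

elemᵇ : ∀ {k} → ℕ → Vec ℕ k → Bool
elemᵇ p [] = false
elemᵇ p (x ∷ xs) = (x ≡ᵇ p) ∨ elemᵇ p xs

filterᵇ : (ℕ → Bool) → List ℕ → List ℕ
filterᵇ P [] = []
filterᵇ P (x ∷ xs) = if P x then x ∷ filterᵇ P xs else filterᵇ P xs

-- minimum of a list, nothing (= ∞) for the empty list
minM : List ℕ → Maybe ℕ
minM [] = nothing
minM (x ∷ xs) with minM xs
... | nothing = just x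
... | just m = just (if x <ᵇ m then x else m)

sameParity : ℕ → ℕ → Bool
sameParity a b = (a % 2) ≡ᵇ (b % 2)

Aval : ∀ {k} → ℕ → Vec ℕ k → Maybe ℕ
Aval ℓ la = minM (filterᵇ (λ p → not (p ≡ᵇ 0) ∧ sameParity p ℓ) (toList la))

Bval : ∀ {k} → ℕ → Vec ℕ k → Maybe ℕ
Bval ℓ la = minM (filterᵇ (λ p → ((mult p la % 2) ≡ᵇ 1) ∧ not (sameParity p ℓ)) (toList la))

-- replace one part equal to a by a ∸ 1 (the last occurrence, keeping the vector sorted)
decLast : ∀ {k} → ℕ → Vec ℕ k → Vec ℕ k
decLast a [] = []
decLast a (x ∷ xs) = if (x ≡ᵇ a) ∧ not (elemᵇ a xs) then (a ∸ 1) ∷ xs else x ∷ decLast a xs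

-- replace one part equal to b by b + 1 (the first occurrence, keeping the vector sorted)
incFirst : ∀ {k} → ℕ → Vec ℕ k → Vec ℕ k
incFirst b [] = []
incFirst b (x ∷ xs) = if x ≡ᵇ b then suc x ∷ xs else x ∷ incFirst b xs

Mmatch : ∀ {k} → ℕ → Vec ℕ k → Maybe (Vec ℕ k)
Mmatch ℓ la with Aval ℓ la | Bval ℓ la
... | nothing | nothing = nothing
... | just a  | nothing = just (decLast a la)
... | nothing | just b  = just (incFirst b la)
... | just a  | just b  = if a <ᵇ b then just (decLast a la) else just (incFirst b la)

IsHasseMatching : (k ℓ : ℕ) → Set
IsHasseMatching k ℓ = ∀ (la μ : Vec ℕ k) → IsPart k ℓ la → Mmatch ℓ la ≡ just μ →
  IsPart k ℓ μ × Mmatch ℓ μ ≡ just la × ((μ ⋖ la) ⊎ (la ⋖ μ))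

data MEdge (k ℓ : ℕ) : Vec ℕ k → Vec ℕ k → Set where
  down : ∀ {la μ} → IsPart k ℓ la → IsPart k ℓ μ → μ ⋖ la → Mmatch ℓ la ≢ just μ → MEdge k ℓ la μ
  up   : ∀ {la μ} → IsPart k ℓ la → IsPart k ℓ μ → μ ⋖ la → Mmatch ℓ la ≡ just μ → MEdge k ℓ μ la

IsAcyclic : (k ℓ : ℕ) → Set
IsAcyclic k ℓ = ∀ (la : Vec ℕ k) → TransClosure (MEdge k ℓ) la la → ⊥

-- subsets of the k × ℓ rectangle of boxes B = Fin k × Fin ℓ (row, column)
Sub : ℕ → ℕ → Set
Sub k ℓ = Vec (Vec Bool ℓ) k

Box : ℕ → ℕ → Set
Box k ℓ = Fin k × Fin ℓ

memS : ∀ {k ℓ} → Sub k ℓ → Box k ℓ → Bool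
memS S (i , j) = lookup (lookup S i) j

insertS : ∀ {k ℓ} → Sub k ℓ → Box k ℓ → Sub k ℓ
insertS S (i , j) = updateAt S i (λ r → updateAt r j (λ _ → true))

boolCount : List Bool → ℕ
boolCount = foldr (λ b n → if b then suc n else n) 0

card : ∀ {k ℓ} → Sub k ℓ → ℕ
card S = foldr _+_ 0 (map boolCount (map toList (toList S)))

allBoxes : (k ℓ : ℕ) → List (Box k ℓ)
allBoxes k ℓ = concatMap (λ i → map (λ j → (i , j)) (allFin ℓ)) (allFin k)

-- an element of C(F₂): coefficient vector (every function is finitely supported)
Chain : ℕ → ℕ → Set
Chain k ℓ = Sub k ℓ → Bool

-- D(e_S) = Σ_{x∈S} e_{S∖x}; coefficient of e_T in D v is Σ_{x∉T} v(T ∪ {x})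
Dif : ∀ {k ℓ} → Chain k ℓ → Chain k ℓ
Dif {k} {ℓ} v T = foldr (λ x acc → (not (memS T x) ∧ v (insertS T x)) xor acc) false (allBoxes k ℓ)

Homog : ∀ {k ℓ} → ℕ → Chain k ℓ → Set
Homog d v = ∀ S → card S ≢ d → v S ≡ false

RowPreserving : ∀ {k ℓ} → (Box k ℓ → Box k ℓ) → Set
RowPreserving f = ∀ x y → proj₁ x ≡ proj₁ y → proj₁ (f x) ≡ proj₁ (f y)

InG : ∀ {k ℓ} → (Box k ℓ ↔ Box k ℓ) → Set
InG g = RowPreserving (Inverse.to g) × RowPreserving (Inverse.from g)

-- g · S = { g x | x ∈ S }
actS : ∀ {k ℓ} → (Box k ℓ ↔ Box k ℓ) → Sub k ℓ → Sub k ℓ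
actS g S = tabulate (λ i → tabulate (λ j → memS S (Inverse.from g (i , j))))

Invariant : ∀ {k ℓ} → Chain k ℓ → Set
Invariant {k} {ℓ} v = ∀ (g : Box k ℓ ↔ Box k ℓ) → InG g → ∀ S → v (actS g S) ≡ v S

OddHomologyVanishes : (k ℓ : ℕ) → Set
OddHomologyVanishes k ℓ = ∀ (d : ℕ) → d % 2 ≡ 1 → ∀ (v : Chain k ℓ) →
  Invariant v → Homog d v → (∀ T → Dif v T ≡ false) →
  Σ (Chain k ℓ) (λ w → Invariant w × Homog (suc d) w × (∀ T → Dif w T ≡ v T))

UnmatchedShape : ∀ {k} → ℕ → Vec ℕ k → Set
UnmatchedShape {k} ℓ la =
  (∀ (i : Fin k) → lookup la i ≢ 0 →
     (mult (lookup la i) la % 2 ≡ 0) × (lookup la i % 2 ≢ ℓ % 2))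
  × (ℓ % 2 ≡ 1 → mult 0 la % 2 ≡ 0)

{-# OPTIONS --safe #-}
module Submission where

-- Call a value q bad for a vector c if q could serve as A(c) or as B(c): q is a nonzero part of the
-- parity of ℓ, or q has the opposite parity and odd multiplicity.  The matching is governed by the
-- least bad value: if it is p + 1 with the parity of ℓ, then c is the upper end of an edge
-- p ↦ p + 1; if it is p with the opposite parity, then c is the lower end of such an edge; without
-- bad values, c is critical.
--
-- Acyclicity: the size of the lower end of the matched pair never increases along a directed path.
-- It stays constant on a step down from an upper element only if the step reaches an element that
-- is not upper, and this forces the step to lower a part 1 to 0 with ℓ even; matched edges do not
-- change the number of zeros when ℓ is even, so this can happen only finitely often.
--
-- Homology: on orbits D only replaces a part p of parity opposite to ℓ by p + 1, with coefficient
-- mult p mod 2 (in terms of coefficient functions).  Hence the matching itself, as a map H from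
-- lower to upper elements, satisfies DH + HD = 1 − (projection to critical elements), with no
-- correction terms along longer gradient paths.  Critical elements have even size, so for an
-- odd-dimensional cycle v the chain Hv bounds v.

open import Defs
open import Data.Nat using (ℕ; zero; suc; _+_; _∸_; _≤_; _<_; _>_; z≤n; s≤s; s≤s⁻¹; _≡ᵇ_; _<ᵇ_; _%_; _≟_)
open import Data.Nat.Properties
open import Data.Bool using (Bool; true; false; not; _∧_; _xor_; if_then_else_)
open import Data.Bool.Properties using (not-distribˡ-xor; not-distribʳ-xor; not-involutive; not-injective; xor-assoc; xor-same; xor-identityʳ; xor-annihilates-not; xor-∧-commutativeRing; ∧-zeroʳ; ∧-distribʳ-xor; ¬-not)
open import Data.Maybe using (Maybe; just; nothing)
open import Data.List using (List; []; _∷_; _++_)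
import Data.List as List
open import Data.List.Properties using (foldr-map)
open import Data.Vec using (Vec; []; _∷_; lookup; toList; updateAt; removeAt; tabulate; map)
open import Data.Vec.Properties using (lookup-map; lookup∘tabulate; tabulate∘lookup; tabulate-cong; map-updateAt)
open import Data.Fin using (Fin; zero; suc; punchIn)
import Data.Fin as F
open import Data.Fin.Permutation using (Permutation; permutation; _⟨$⟩ʳ_; _⟨$⟩ˡ_; inverseˡ; inverseʳ; insert; insert-punchIn)
import Data.Fin.Permutation as Perm
open import Data.Product using (_×_; _,_; proj₁; proj₂; ∃; Σ)
open import Data.Product.Relation.Binary.Lex.Strict using (×-Lex; ×-transitive; ×-asymmetric)
open import Data.Sum using (_⊎_; inj₁; inj₂; [_,_])
open import Data.Empty using (⊥; ⊥-elim)
open import Function.Base using (_∘_)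
open import Function.Bundles using (_⇔_; mk⇔; _↔_; Inverse; mk↔ₛ′)
open import Relation.Nullary using (¬_; yes; no; contradiction; Reflects; ofʸ; ofⁿ; proof; Dec)
open import Relation.Binary.Definitions using (tri<; tri≈; tri>; Transitive; Asymmetric)
open import Relation.Binary.PropositionalEquality
open import Relation.Binary.Construct.Closure.Transitive using (TransClosure; [_]; _∷_)
open import Algebra.Bundles using (CommutativeRing)
open import Algebra.Properties.CommutativeSemigroup +-commutativeSemigroup using (x∙yz≈y∙xz)
open import Algebra.Properties.CommutativeSemigroup (CommutativeRing.+-commutativeSemigroup xor-∧-commutativeRing) using () renaming (interchange to xor-interchange; x∙yz≈y∙xz to xor-swapˡ)
open import Algebra.Properties.CommutativeMonoid.Sum +-0-commutativeMonoid using (sum; sum-permute; sum-cong-≗)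

private
  variable
    k ℓ : ℕ

-- Equality tests and parities.

≡ᵇ-reflects : ∀ x y → Reflects (x ≡ y) (x ≡ᵇ y)
≡ᵇ-reflects x y = proof (x ≟ y)

≡ᵇ-refl : ∀ x → (x ≡ᵇ x) ≡ true
≡ᵇ-refl zero = refl
≡ᵇ-refl (suc x) = ≡ᵇ-refl x

≢⇒≡ᵇ : ∀ {x y} → x ≢ y → (x ≡ᵇ y) ≡ false
≢⇒≡ᵇ {x} {y} x≢y with x ≡ᵇ y | ≡ᵇ-reflects x y
... | true  | ofʸ x≡y = contradiction x≡y x≢y
... | false | _ = refl

true≢false : ∀ {b} → b ≡ true → b ≢ false
true≢false refl ()

not≡ᵇ0 : ∀ {n} → not (n ≡ᵇ 0) ≡ false → n ≡ 0
not≡ᵇ0 {zero} _ = refl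

bit : Bool → ℕ
bit b = if b then 1 else 0

odd : ℕ → Bool
odd zero = false
odd (suc n) = not (odd n)

%2≡bit : ∀ n → n % 2 ≡ bit (odd n)
%2≡bit zero = refl
%2≡bit (suc zero) = refl
%2≡bit (suc (suc n)) = trans (%2≡bit n) (cong bit (sym (not-involutive (odd n))))

%2≡ᵇ1 : ∀ n → ((n % 2) ≡ᵇ 1) ≡ odd n
%2≡ᵇ1 n rewrite %2≡bit n with odd n
... | true = refl
... | false = refl

odd-+ : ∀ m n → odd (m + n) ≡ odd m xor odd n
odd-+ zero n = refl
odd-+ (suc m) n = trans (cong not (odd-+ m n)) (not-distribˡ-xor (odd m) (odd n))

odd⇒≢0 : ∀ {n} → odd n ≡ true → n ≢ 0
odd⇒≢0 () refl

-- Multiplicities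

mult-∷ : ∀ q x (xs : Vec ℕ k) → mult q (x ∷ xs) ≡ bit (x ≡ᵇ q) + mult q xs
mult-∷ q x xs with x ≡ᵇ q
... | true = refl
... | false = refl

mult-lookup : ∀ (c : Vec ℕ k) i → mult (lookup c i) c ≢ 0
mult-lookup (x ∷ c) zero rewrite ≡ᵇ-refl x = λ ()
mult-lookup (x ∷ c) (suc i) with x ≡ᵇ lookup c i
... | true = λ ()
... | false = mult-lookup c i

mult≢0⇒lookup : ∀ q (c : Vec ℕ k) → mult q c ≢ 0 → ∃ λ i → lookup c i ≡ q
mult≢0⇒lookup q [] m≢0 = contradiction refl m≢0
mult≢0⇒lookup q (x ∷ c) m≢0 with x ≡ᵇ q | ≡ᵇ-reflects x q
... | true  | ofʸ x≡q = zero , x≡q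
... | false | _ with mult≢0⇒lookup q c m≢0
... | i , eq = suc i , eq

elemᵇ≡ : ∀ q (c : Vec ℕ k) → elemᵇ q c ≡ not (mult q c ≡ᵇ 0)
elemᵇ≡ q [] = refl
elemᵇ≡ q (x ∷ c) with x ≡ᵇ q
... | true = refl
... | false = elemᵇ≡ q c

infix 4 _≈_
-- Equality as multisets of parts. The argument runs on multisets; equality of vectors is recovered
-- only at the end, from sortedness.
_≈_ : ∀ {k} → Vec ℕ k → Vec ℕ k → Set
c ≈ c′ = ∀ q → mult q c ≡ mult q c′

≈-sym : {c c′ : Vec ℕ k} → c ≈ c′ → c′ ≈ c
≈-sym e q = sym (e q)

≈-tail : ∀ x {xs ys : Vec ℕ k} → x ∷ xs ≈ x ∷ ys → xs ≈ ys
≈-tail x {xs} {ys} e q = +-cancelˡ-≡ (bit (x ≡ᵇ q)) _ _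
  (trans (sym (mult-∷ q x xs)) (trans (e q) (mult-∷ q x ys)))

Sorted : Vec ℕ k → Set
Sorted {k} c = ∀ (i j : Fin k) → i F.≤ j → lookup c j ≤ lookup c i

sorted-tail : ∀ {x} {xs : Vec ℕ k} → Sorted (x ∷ xs) → Sorted xs
sorted-tail s i j i≤j = s (suc i) (suc j) (s≤s i≤j)

sorted-∷ : ∀ {x} {xs : Vec ℕ k} → (∀ i → lookup xs i ≤ x) → Sorted xs → Sorted (x ∷ xs)
sorted-∷ ub s zero zero _ = ≤-refl
sorted-∷ ub s zero (suc j) _ = ub j
sorted-∷ ub s (suc i) (suc j) i≤j = s i j (s≤s⁻¹ i≤j)

head-≤ : ∀ {x y} {xs ys : Vec ℕ k} → Sorted (y ∷ ys) → x ∷ xs ≈ y ∷ ys → x ≤ y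
head-≤ {x = x} {y} {xs} {ys} s e
  with mult≢0⇒lookup x (y ∷ ys) (subst (_≢ 0) (e x) (mult-lookup (x ∷ xs) zero))
... | i , refl = s zero i z≤n

-- Equal multisets have equal maxima, and the maximum of a sorted vector is its head; so the heads
-- agree and can be cancelled.
sorted-≈⇒≡ : {c c′ : Vec ℕ k} → Sorted c → Sorted c′ → c ≈ c′ → c ≡ c′
sorted-≈⇒≡ {c = []} {[]} _ _ _ = refl
sorted-≈⇒≡ {c = x ∷ xs} {y ∷ ys} s s′ e with ≤-antisym (head-≤ {xs = xs} s′ e) (head-≤ {xs = ys} s (≈-sym {c = x ∷ xs} {y ∷ ys} e))
... | refl = cong (x ∷_) (sorted-≈⇒≡ (sorted-tail s) (sorted-tail s′) (≈-tail x {xs} {ys} e))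

-- Raising one part

-- The position of the raised part is left free, so that `incFirst`, `decLast` and `updateAt` are
-- all instances, on unsorted vectors as well.
data Inc (p : ℕ) : ∀ {k} → Vec ℕ k → Vec ℕ k → Set where
  here  : {c : Vec ℕ k} → Inc p (p ∷ c) (suc p ∷ c)
  there : ∀ {x} {c d : Vec ℕ k} → Inc p c d → Inc p (x ∷ c) (x ∷ d)

-- As multisets, `d` together with `p` is `c` together with `suc p`. The additive form avoids
-- truncated subtraction; the later facts on multiplicities follow by cancelling.
inc-mult : ∀ {p} {c d : Vec ℕ k} → Inc p c d → ∀ q →
  bit (p ≡ᵇ q) + mult q d ≡ bit (suc p ≡ᵇ q) + mult q c
inc-mult {p = p} (here {c = c}) q
  rewrite mult-∷ q p c | mult-∷ q (suc p) c = x∙yz≈y∙xz (bit (p ≡ᵇ q)) (bit (suc p ≡ᵇ q)) (mult q c)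
inc-mult {p = p} (there {x = x} {c} {d} i) q
  rewrite mult-∷ q x c | mult-∷ q x d
        | x∙yz≈y∙xz (bit (p ≡ᵇ q)) (bit (x ≡ᵇ q)) (mult q d)
        | x∙yz≈y∙xz (bit (suc p ≡ᵇ q)) (bit (x ≡ᵇ q)) (mult q c) = cong (bit (x ≡ᵇ q) +_) (inc-mult i q)

inc-mult-≢ : ∀ {p q} {c d : Vec ℕ k} → Inc p c d → p ≢ q → suc p ≢ q → mult q c ≡ mult q d
inc-mult-≢ {p = p} {q} i p≢q sp≢q with inc-mult i q
... | e rewrite ≢⇒≡ᵇ p≢q | ≢⇒≡ᵇ sp≢q = sym e

inc-mult-lo : ∀ {p} {c d : Vec ℕ k} → Inc p c d → mult p c ≡ suc (mult p d)
inc-mult-lo {p = p} i with inc-mult i p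
... | e rewrite ≡ᵇ-refl p | ≢⇒≡ᵇ (1+n≢n {p}) = sym e

inc-mult-hi : ∀ {p} {c d : Vec ℕ k} → Inc p c d → mult (suc p) d ≡ suc (mult (suc p) c)
inc-mult-hi {p = p} i with inc-mult i (suc p)
... | e rewrite ≡ᵇ-refl p | ≢⇒≡ᵇ (1+n≢n {p} ∘ sym) = e

inc-mult-< : ∀ {p q} {c d : Vec ℕ k} → Inc p c d → q < p → mult q c ≡ mult q d
inc-mult-< i q<p = inc-mult-≢ i (>⇒≢ q<p) (>⇒≢ (m<n⇒m<1+n q<p))

inc-size : ∀ {p} {c d : Vec ℕ k} → Inc p c d → size d ≡ suc (size c)
inc-size here = refl
inc-size (there {x = x} i) = trans (cong (x +_) (inc-size i)) (+-suc x _)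

inc-⋖ : ∀ {p} {c d : Vec ℕ k} → Inc p c d → c ⋖ d
inc-⋖ i = ⊑ i , inc-size i
  where
  ⊑ : ∀ {k p} {c d : Vec ℕ k} → Inc p c d → c ⊑ d
  ⊑ here zero = n≤1+n _
  ⊑ here (suc j) = ≤-refl
  ⊑ (there i) zero = ≤-refl
  ⊑ (there i) (suc j) = ⊑ i j

⊑⇒size≤ : (c d : Vec ℕ k) → c ⊑ d → size c ≤ size d
⊑⇒size≤ [] [] _ = z≤n
⊑⇒size≤ (x ∷ c) (y ∷ d) le = +-mono-≤ (le zero) (⊑⇒size≤ c d (le ∘ suc))

⊑∧size≡⇒≡ : (c d : Vec ℕ k) → c ⊑ d → size c ≡ size d → c ≡ d
⊑∧size≡⇒≡ [] [] _ _ = refl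
⊑∧size≡⇒≡ (x ∷ c) (y ∷ d) le eq with m≤n⇒m<n∨m≡n (le zero)
... | inj₁ x<y = contradiction eq (<⇒≢ (+-mono-<-≤ x<y (⊑⇒size≤ c d (le ∘ suc))))
... | inj₂ refl = cong (x ∷_) (⊑∧size≡⇒≡ c d (le ∘ suc) (+-cancelˡ-≡ x _ _ eq))

-- At the first strict entry a jump of two or more would exceed the size difference. So the jump is
-- one, and the tails, of equal size, coincide.
⋖⇒inc : (c d : Vec ℕ k) → c ⋖ d → ∃ λ p → Inc p c d
⋖⇒inc [] [] (_ , ())
⋖⇒inc (x ∷ c) (y ∷ d) (le , eq) with m≤n⇒m<n∨m≡n (le zero)
... | inj₂ refl with ⋖⇒inc c d (le ∘ suc , +-cancelˡ-≡ x _ _ (trans eq (sym (+-suc x (size c)))))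
... | p , i = p , there i
⋖⇒inc (x ∷ c) (y ∷ d) (le , eq) | inj₁ x<y with m≤n⇒m<n∨m≡n x<y
... | inj₁ 1+x<y = contradiction (sym eq) (<⇒≢ (+-mono-<-≤ 1+x<y (⊑⇒size≤ c d (le ∘ suc))))
... | inj₂ refl with ⊑∧size≡⇒≡ c d (le ∘ suc) (sym (+-cancelˡ-≡ (suc x) _ _ eq))
... | refl = x , here

incFirst-Inc : ∀ p (c : Vec ℕ k) → mult p c ≢ 0 → Inc p c (incFirst p c)
incFirst-Inc p [] m≢0 = contradiction refl m≢0
incFirst-Inc p (x ∷ c) m≢0 with x ≡ᵇ p | ≡ᵇ-reflects x p
... | true  | ofʸ refl = here
... | false | _ = there (incFirst-Inc p c m≢0)

decLast-Inc : ∀ p (c : Vec ℕ k) → mult (suc p) c ≢ 0 → Inc p (decLast (suc p) c) c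
decLast-Inc p [] m≢0 = contradiction refl m≢0
decLast-Inc p (x ∷ c) m≢0 with x ≡ᵇ suc p | ≡ᵇ-reflects x (suc p) | elemᵇ (suc p) c | elemᵇ≡ (suc p) c
... | true | ofʸ refl | false | _ = here
... | true | ofʸ refl | true | e = there (decLast-Inc p c (λ m≡0 → true≢false (sym e) (cong (λ n → not (n ≡ᵇ 0)) m≡0)))
... | false | _ | _ | _ = there (decLast-Inc p c m≢0)

updateAt-Inc : ∀ (c : Vec ℕ k) i → Inc (lookup c i) c (updateAt c i suc)
updateAt-Inc (x ∷ c) zero = here
updateAt-Inc (x ∷ c) (suc i) = there (updateAt-Inc c i)

inc-det : ∀ {p} {c d c′ d′ : Vec ℕ k} → Inc p c d → Inc p c′ d′ → c ≈ c′ → d ≈ d′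
inc-det {p = p} i i′ e q = +-cancelˡ-≡ (bit (p ≡ᵇ q)) _ _
  (trans (inc-mult i q) (trans (cong (bit (suc p ≡ᵇ q) +_) (e q)) (sym (inc-mult i′ q))))

inc-inj : ∀ {p} {c d c′ d′ : Vec ℕ k} → Inc p c d → Inc p c′ d′ → d ≈ d′ → c ≈ c′
inc-inj {p = p} i i′ e q = +-cancelˡ-≡ (bit (suc p ≡ᵇ q)) _ _
  (trans (sym (inc-mult i q)) (trans (cong (bit (p ≡ᵇ q) +_) (e q)) (inc-mult i′ q)))

-- Only a part equal to `u` could be pushed above `u`. With `u` the head this gives sortedness, with
-- `u` equal to `ℓ` the bound on parts.
incFirst-≤ : ∀ p u (c : Vec ℕ k) → p ≢ u → (∀ i → lookup c i ≤ u) → ∀ i → lookup (incFirst p c) i ≤ u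
incFirst-≤ p u (x ∷ c) p≢u le i with x ≡ᵇ p | ≡ᵇ-reflects x p
incFirst-≤ p u (x ∷ c) p≢u le zero    | true | ofʸ refl = ≤∧≢⇒< (le zero) p≢u
incFirst-≤ p u (x ∷ c) p≢u le (suc i) | true | ofʸ refl = le (suc i)
incFirst-≤ p u (x ∷ c) p≢u le zero    | false | _ = le zero
incFirst-≤ p u (x ∷ c) p≢u le (suc i) | false | _ = incFirst-≤ p u c p≢u (le ∘ suc) i

incFirst-sorted : ∀ p (c : Vec ℕ k) → Sorted c → Sorted (incFirst p c)
incFirst-sorted p [] s = s
incFirst-sorted p (x ∷ c) s with x ≡ᵇ p | ≡ᵇ-reflects x p
... | true  | _ = sorted-∷ (λ i → m≤n⇒m≤1+n (s zero (suc i) z≤n)) (sorted-tail s)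
... | false | ofⁿ x≢p = sorted-∷ (incFirst-≤ p x c (x≢p ∘ sym) (λ i → s zero (suc i) z≤n))
                                 (incFirst-sorted p c (sorted-tail s))

decLast-⊑ : ∀ p (c : Vec ℕ k) → decLast (suc p) c ⊑ c
decLast-⊑ p (x ∷ c) i with x ≡ᵇ suc p | ≡ᵇ-reflects x (suc p) | elemᵇ (suc p) c
decLast-⊑ p (x ∷ c) zero    | true  | ofʸ refl | false = n≤1+n p
decLast-⊑ p (x ∷ c) (suc i) | true  | ofʸ refl | false = ≤-refl
decLast-⊑ p (x ∷ c) zero    | true  | _ | true = ≤-refl
decLast-⊑ p (x ∷ c) (suc i) | true  | _ | true = decLast-⊑ p c i
decLast-⊑ p (x ∷ c) zero    | false | _ | _ = ≤-refl
decLast-⊑ p (x ∷ c) (suc i) | false | _ | _ = decLast-⊑ p c i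

decLast-sorted : ∀ p (c : Vec ℕ k) → Sorted c → Sorted (decLast (suc p) c)
decLast-sorted p [] s = s
decLast-sorted p (x ∷ c) s
  with x ≡ᵇ suc p | ≡ᵇ-reflects x (suc p) | elemᵇ (suc p) c | elemᵇ≡ (suc p) c | rest
  where
  rest : Sorted (x ∷ decLast (suc p) c)
  rest = sorted-∷ (λ i → ≤-trans (decLast-⊑ p c i) (s zero (suc i) z≤n)) (decLast-sorted p c (sorted-tail s))
... | true | ofʸ refl | false | e | _ =
  -- The last `suc p` is lowered, so `suc p` is absent from the tail, whose entries are therefore at
  -- most `p`.
  sorted-∷ (λ i → s≤s⁻¹ (≤∧≢⇒< (s zero (suc i) z≤n) (λ eq → mult-lookup c i (absent (lookup c i) eq)))) (sorted-tail s)
  where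
  absent : ∀ y → y ≡ suc p → mult y c ≡ 0
  absent _ refl = not≡ᵇ0 (sym e)
... | true | _ | true | _ | r = r
... | false | _ | _ | _ | r = r

-- The first bad part value

module _ (ℓ : ℕ) where

  opp : ℕ → Bool
  opp q = odd q xor odd ℓ

  opp-suc : ∀ q → opp (suc q) ≡ not (opp q)
  opp-suc q = sym (not-distribˡ-xor (odd q) (odd ℓ))

  opp-ℓ : opp ℓ ≡ false
  opp-ℓ = xor-same (odd ℓ)

  bad : Vec ℕ k → ℕ → Bool
  bad c q = if opp q then odd (mult q c) else (not (q ≡ᵇ 0) ∧ not (mult q c ≡ᵇ 0))

  FirstBad : Vec ℕ k → ℕ → Set
  FirstBad c q = bad c q ≡ true × (∀ {r} → r < q → bad c r ≡ false)

  bad-cong : ∀ {q} {c d : Vec ℕ k} → mult q c ≡ mult q d → bad c q ≡ bad d q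
  bad-cong {q = q} e = cong (λ m → if opp q then odd m else (not (q ≡ᵇ 0) ∧ not (m ≡ᵇ 0))) e

  bad-opp : ∀ {q} (c : Vec ℕ k) → opp q ≡ true → bad c q ≡ odd (mult q c)
  bad-opp c o rewrite o = refl

  bad-same : ∀ {q} (c : Vec ℕ k) → opp (suc q) ≡ false → bad c (suc q) ≡ not (mult (suc q) c ≡ᵇ 0)
  bad-same c o rewrite o = refl

  bad⇒mult≢0 : ∀ {q} (c : Vec ℕ k) → bad c q ≡ true → mult q c ≢ 0
  bad⇒mult≢0 {q = q} c b m≡0 = true≢false b (trans (cong badIf m≡0) (absent (opp q)))
    where
    badIf : ℕ → Bool
    badIf m = if opp q then odd m else (not (q ≡ᵇ 0) ∧ not (m ≡ᵇ 0))
    absent : ∀ o → (if o then false else (not (q ≡ᵇ 0) ∧ false)) ≡ false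
    absent true = refl
    absent false = ∧-zeroʳ (not (q ≡ᵇ 0))

  mult≢0⇒bad : ∀ {q} (c : Vec ℕ k) → opp (suc q) ≡ false → mult (suc q) c ≢ 0 → bad c (suc q) ≡ true
  mult≢0⇒bad {q = q} c o m≢0 = trans (bad-same c o) (cong not (≢⇒≡ᵇ m≢0))

  firstBad-unique : ∀ {p q} (c : Vec ℕ k) → FirstBad c p → FirstBad c q → p ≡ q
  firstBad-unique {p = p} {q} c (bp , gp) (bq , gq) with <-cmp p q
  ... | tri< p<q _ _ = contradiction (gq p<q) (true≢false bp)
  ... | tri≈ _ p≡q _ = p≡q
  ... | tri> _ _ q<p = contradiction (gp q<p) (true≢false bq)

  firstBad-cong : ∀ {p} {c d : Vec ℕ k} → (∀ {q} → q ≤ p → mult q c ≡ mult q d) → FirstBad c p → FirstBad d p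
  firstBad-cong {c = c} {d} e (b , g) =
    trans (sym (bad-cong {c = c} {d} (e ≤-refl))) b ,
    λ r<p → trans (sym (bad-cong {c = c} {d} (e (<⇒≤ r<p)))) (g r<p)

  -- Both ends of a matched edge carry the same index `p`: the first bad value is `p` at the lower
  -- end and `suc p` at the upper end.
  Lower Upper : ℕ → Vec ℕ k → Set
  Lower p c = FirstBad c p × opp p ≡ true
  Upper p c = FirstBad c (suc p) × opp p ≡ true

  opp-suc-false : ∀ p → opp p ≡ true → opp (suc p) ≡ false
  opp-suc-false p o = trans (opp-suc p) (cong not o)

  lower∧upper : ∀ {p q} (c : Vec ℕ k) → Lower p c → Upper q c → ⊥
  lower∧upper {p = p} {q} c (fp , op) (fq , oq) with firstBad-unique c fp fq
  ... | refl = true≢false op (opp-suc-false q oq)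

  -- Removing one `p` makes its odd multiplicity even, hence `p` good, and the new part `suc p` has
  -- the parity of `ℓ`. Smaller values are untouched.
  upper-inc : ∀ {p} {c d : Vec ℕ k} → Inc p c d → Lower p c → Upper p d
  upper-inc {p = p} {c} {d} i ((b , g) , o) = (mult≢0⇒bad d (opp-suc-false p o) m≢0 , good) , o
    where
    m≢0 : mult (suc p) d ≢ 0
    m≢0 rewrite inc-mult-hi i = λ ()
    even-p : odd (mult p d) ≡ false
    even-p = not-injective (trans (sym (cong odd (inc-mult-lo i))) (trans (sym (bad-opp c o)) b))
    good : ∀ {r} → r < suc p → bad d r ≡ false
    good r<1+p with m≤n⇒m<n∨m≡n (s≤s⁻¹ r<1+p)
    ... | inj₁ r<p = trans (sym (bad-cong {c = c} {d} (inc-mult-< i r<p))) (g r<p)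
    ... | inj₂ refl = trans (bad-opp d o) even-p

  -- Since `p` lies below the first bad value of `d`, its multiplicity there is even; the additional
  -- copy in `c` makes it odd.
  lower-inc : ∀ {p} {c d : Vec ℕ k} → Inc p c d → Upper p d → Lower p c
  lower-inc {p = p} {c} {d} i ((b , g) , o) =
    (trans (bad-opp c o) (trans (cong odd (inc-mult-lo i)) (cong not (trans (sym (bad-opp d o)) (g ≤-refl)))) ,
     λ r<p → trans (bad-cong {c = c} {d} (inc-mult-< i r<p)) (g (m<n⇒m<1+n r<p))) , o

  upper-Inc : ∀ {p} (d : Vec ℕ k) → Upper p d → Inc p (decLast (suc p) d) d
  upper-Inc d u = decLast-Inc _ d (bad⇒mult≢0 d (proj₁ (proj₁ u)))

  lower-Inc : ∀ {p} (c : Vec ℕ k) → Lower p c → Inc p c (incFirst p c)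
  lower-Inc c l = incFirst-Inc _ c (bad⇒mult≢0 c (proj₁ (proj₁ l)))

  -- Indexed by the result of `Mmatch`, so that one case split yields both the partner and the
  -- reason for it.
  data Class (c : Vec ℕ k) : Maybe (Vec ℕ k) → Set where
    upper    : ∀ p → Upper p c → Class c (just (decLast (suc p) c))
    lower    : ∀ p → Lower p c → Class c (just (incFirst p c))
    critical : (∀ q → bad c q ≡ false) → Class c nothing

-- The minima A and B, and the matching in terms of first bad values.

data MinSpec (P : ℕ → Bool) (c : Vec ℕ k) : Maybe ℕ → Set where
  none : (∀ q → P q ≡ true → mult q c ≡ 0) → MinSpec P c nothing
  some : ∀ m → P m ≡ true → mult m c ≢ 0 → (∀ q → P q ≡ true → mult q c ≢ 0 → m ≤ q) → MinSpec P c (just m)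

minSpec-keep : ∀ {P x} {c : Vec ℕ k} {m} → P x ≡ false → MinSpec P c m → MinSpec P (x ∷ c) m
minSpec-keep {P = P} {x} {c} x∉ s = keep s
  where
  same : ∀ q → P q ≡ true → mult q (x ∷ c) ≡ mult q c
  same q Pq with x ≡ᵇ q | ≡ᵇ-reflects x q
  ... | true | ofʸ refl = contradiction x∉ (true≢false Pq)
  ... | false | _ = refl
  keep : ∀ {m} → MinSpec P c m → MinSpec P (x ∷ c) m
  keep (none f) = none λ q Pq → trans (same q Pq) (f q Pq)
  keep (some m Pm m∈ f) = some m Pm (subst (_≢ 0) (sym (same m Pm)) m∈)
    λ q Pq q∈ → f q Pq (subst (_≢ 0) (same q Pq) q∈)

mult-∷⁻ : ∀ {q} x (c : Vec ℕ k) → mult q (x ∷ c) ≢ 0 → x ≡ q ⊎ mult q c ≢ 0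
mult-∷⁻ {q = q} x c q∈ with x ≡ᵇ q | ≡ᵇ-reflects x q
... | true | ofʸ x≡q = inj₁ x≡q
... | false | _ = inj₂ q∈

mult-∷⁺ : ∀ {q} x (c : Vec ℕ k) → mult q c ≢ 0 → mult q (x ∷ c) ≢ 0
mult-∷⁺ {q = q} x c q∈ with x ≡ᵇ q
... | true = λ ()
... | false = q∈

minSpec : ∀ P (c : Vec ℕ k) → MinSpec P c (minM (filterᵇ P (toList c)))
minSpec P [] = none λ _ _ → refl
minSpec P (x ∷ c) with P x in Px
... | false = minSpec-keep Px (minSpec P c)
... | true with minM (filterᵇ P (toList c)) | minSpec P c
... | nothing | none f = some x Px (mult-lookup (x ∷ c) zero) least
  where
  least : ∀ q → P q ≡ true → mult q (x ∷ c) ≢ 0 → x ≤ q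
  least q Pq q∈ with mult-∷⁻ x c q∈
  ... | inj₁ refl = ≤-refl
  ... | inj₂ q∈c = contradiction (f q Pq) q∈c
... | just m | some .m Pm m∈ f with x <ᵇ m | <ᵇ-reflects-< x m
... | true  | ofʸ x<m = some x Px (mult-lookup (x ∷ c) zero) least
  where
  least : ∀ q → P q ≡ true → mult q (x ∷ c) ≢ 0 → x ≤ q
  least q Pq q∈ with mult-∷⁻ x c q∈
  ... | inj₁ refl = ≤-refl
  ... | inj₂ q∈c = ≤-trans (<⇒≤ x<m) (f q Pq q∈c)
... | false | ofⁿ x≮m = some m Pm (mult-∷⁺ x c m∈) least
  where
  least : ∀ q → P q ≡ true → mult q (x ∷ c) ≢ 0 → m ≤ q
  least q Pq q∈ with mult-∷⁻ x c q∈
  ... | inj₁ refl = ≮⇒≥ x≮m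
  ... | inj₂ q∈c = f q Pq q∈c

module _ (ℓ : ℕ) where

  sameParity≡ : ∀ q → sameParity q ℓ ≡ not (opp ℓ q)
  sameParity≡ q rewrite %2≡bit q | %2≡bit ℓ with odd q | odd ℓ
  ... | true  | true = refl
  ... | true  | false = refl
  ... | false | true = refl
  ... | false | false = refl

  candidateA : ℕ → Bool
  candidateA p = not (p ≡ᵇ 0) ∧ sameParity p ℓ

  candidateB : Vec ℕ k → ℕ → Bool
  candidateB c p = ((mult p c % 2) ≡ᵇ 1) ∧ not (sameParity p ℓ)

  candidateA-view : ∀ q → candidateA q ≡ true → ∃ λ p → q ≡ suc p × opp ℓ p ≡ true
  candidateA-view (suc p) e = p , refl ,
    not-injective (trans (sym (opp-suc ℓ p)) (not-injective (trans (sym (sameParity≡ (suc p))) e)))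

  candidateB-view : ∀ q (c : Vec ℕ k) → candidateB c q ≡ true → opp ℓ q ≡ true × bad ℓ c q ≡ true
  candidateB-view q c e rewrite sameParity≡ q | %2≡ᵇ1 (mult q c) with opp ℓ q | odd (mult q c)
  ... | true | true = refl , refl
  ... | true | false = contradiction e λ ()
  ... | false | true = contradiction e λ ()
  ... | false | false = contradiction e λ ()

  bad-view : ∀ q (c : Vec ℕ k) → bad ℓ c q ≡ true → candidateA q ≡ true ⊎ candidateB c q ≡ true
  bad-view q c b rewrite sameParity≡ q | %2≡ᵇ1 (mult q c) with opp ℓ q | odd (mult q c) | q ≡ᵇ 0
  ... | true | true | _ = inj₂ refl
  ... | false | _ | false = inj₁ refl
  ... | true | false | _ = contradiction b λ ()
  ... | false | _ | true = contradiction b λ ()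

  good-below : ∀ {r} (c : Vec ℕ k) → ¬ (candidateA r ≡ true × mult r c ≢ 0) → ¬ (candidateB c r ≡ true × mult r c ≢ 0) →
    bad ℓ c r ≡ false
  good-below {r = r} c ¬A ¬B = ¬-not λ b →
    [_,_] (λ P → ¬A (P , bad⇒mult≢0 ℓ c b)) (λ P → ¬B (P , bad⇒mult≢0 ℓ c b)) (bad-view r c b)

  -- The bad values are exactly the occurring candidates for A and for B, so the smaller of the two
  -- minima is the first bad value.
  classify : (c : Vec ℕ k) → Class ℓ c (Mmatch ℓ c)
  classify c with Aval ℓ c | minSpec candidateA c | Bval ℓ c | minSpec (candidateB c) c
  ... | nothing | none fA | nothing | none fB =
    critical λ q → good-below c (λ (P , q∈) → q∈ (fA q P)) (λ (P , q∈) → q∈ (fB q P))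
  ... | just a | some .a Pa a∈ fA | nothing | none fB with candidateA-view a Pa
  ...   | p , refl , o = upper p ((mult≢0⇒bad ℓ c (opp-suc-false ℓ p o) a∈ ,
            λ {r} r<a → good-below c (λ (P , r∈) → <⇒≱ r<a (fA r P r∈)) (λ (P , r∈) → r∈ (fB r P))) , o)
  classify c | nothing | none fA | just b | some .b Pb b∈ fB with candidateB-view b c Pb
  ...   | o , bb = lower b ((bb ,
            λ {r} r<b → good-below c (λ (P , r∈) → r∈ (fA r P)) (λ (P , r∈) → <⇒≱ r<b (fB r P r∈))) , o)
  classify c | just a | some .a Pa a∈ fA | just b | some .b Pb b∈ fB with a <ᵇ b | <ᵇ-reflects-< a b
  ...   | true | ofʸ a<b with candidateA-view a Pa
  ...     | p , refl , o = upper p ((mult≢0⇒bad ℓ c (opp-suc-false ℓ p o) a∈ ,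
              λ {r} r<a → good-below c (λ (P , r∈) → <⇒≱ r<a (fA r P r∈))
                                     (λ (P , r∈) → <⇒≱ (<-trans r<a a<b) (fB r P r∈))) , o)
  classify c | just a | some .a Pa a∈ fA | just b | some .b Pb b∈ fB | false | ofⁿ a≮b with candidateB-view b c Pb
  ...     | o , bb = lower b ((bb ,
              λ {r} r<b → good-below c (λ (P , r∈) → <⇒≱ (<-≤-trans r<b (≮⇒≥ a≮b)) (fA r P r∈))
                                     (λ (P , r∈) → <⇒≱ r<b (fB r P r∈))) , o)

  Mmatch-upper : ∀ {p} (c : Vec ℕ k) → Upper ℓ p c → Mmatch ℓ c ≡ just (decLast (suc p) c)
  Mmatch-upper {p = p} c u with Mmatch ℓ c | classify c
  ... | _ | upper q u′ = cong (λ a → just (decLast a c)) (firstBad-unique ℓ c (proj₁ u′) (proj₁ u))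
  ... | _ | lower q l = ⊥-elim (lower∧upper ℓ c l u)
  ... | _ | critical g = contradiction (g (suc p)) (true≢false (proj₁ (proj₁ u)))

  Mmatch-lower : ∀ {p} (c : Vec ℕ k) → Lower ℓ p c → Mmatch ℓ c ≡ just (incFirst p c)
  Mmatch-lower {p = p} c l with Mmatch ℓ c | classify c
  ... | _ | upper q u = ⊥-elim (lower∧upper ℓ c l u)
  ... | _ | lower q l′ = cong (λ a → just (incFirst a c)) (firstBad-unique ℓ c (proj₁ l′) (proj₁ l))
  ... | _ | critical g = contradiction (g p) (true≢false (proj₁ (proj₁ l)))

  -- The partner is of the other type with the same index, so matching again undoes the move as
  -- multisets, hence also as sorted vectors.
  isHasseMatching : IsHasseMatching k ℓ
  isHasseMatching c d (bnd , srt) eq with Mmatch ℓ c | classify c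
  isHasseMatching c d (bnd , srt) refl | _ | upper p u =
    ((λ i → ≤-trans (decLast-⊑ p c i) (bnd i)) , srt′) ,
    trans (Mmatch-lower d l) (cong just (sorted-≈⇒≡ (incFirst-sorted p d srt′) srt
      (inc-det (lower-Inc ℓ d l) i (λ _ → refl)))) ,
    inj₁ (inc-⋖ i)
    where
    i = upper-Inc ℓ c u
    l = lower-inc ℓ i u
    srt′ = decLast-sorted p c srt
  isHasseMatching c d (bnd , srt) refl | _ | lower p l =
    -- The raised part differs from `ℓ` in parity, so it stays within the bound `ℓ`.
    (incFirst-≤ p ℓ c (λ { refl → true≢false (proj₂ l) (opp-ℓ ℓ) }) bnd , srt′) ,
    trans (Mmatch-upper d u) (cong just (sorted-≈⇒≡ (decLast-sorted p d srt′) srt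
      (inc-inj (upper-Inc ℓ d u) i (λ _ → refl)))) ,
    inj₂ (inc-⋖ i)
    where
    i = lower-Inc ℓ c l
    u = upper-inc ℓ i l
    srt′ = incFirst-sorted p c srt

-- Critical elements and acyclicity

even%2 : ∀ {n} → odd n ≡ false → n % 2 ≡ 0
even%2 {n} e = trans (%2≡bit n) (cong bit e)

odd%2 : ∀ {n} → odd n ≡ true → n % 2 ≡ 1
odd%2 {n} e = trans (%2≡bit n) (cong bit e)

%2-odd : ∀ {n} → n % 2 ≡ 1 → odd n ≡ true
%2-odd {n} e with odd n | %2≡bit n
... | true | _ = refl
... | false | e′ = contradiction (trans (sym e′) e) λ ()

module _ (ℓ : ℕ) where

  opp⇒%2≢ : ∀ {q} → opp ℓ q ≡ true → q % 2 ≢ ℓ % 2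
  opp⇒%2≢ {q} o e rewrite %2≡bit q | %2≡bit ℓ with odd q | odd ℓ
  ... | true  | true = contradiction o λ ()
  ... | true  | false = contradiction e λ ()
  ... | false | true = contradiction e λ ()
  ... | false | false = contradiction o λ ()

  same⇒%2≡ : ∀ {q} → opp ℓ q ≡ false → q % 2 ≡ ℓ % 2
  same⇒%2≡ {q} o rewrite %2≡bit q | %2≡bit ℓ with odd q | odd ℓ
  ... | true  | true = refl
  ... | true  | false = contradiction o λ ()
  ... | false | true = contradiction o λ ()
  ... | false | false = refl

  good⇒opp : ∀ {q} (c : Vec ℕ k) → bad ℓ c q ≡ false → mult q c ≢ 0 → q ≢ 0 → opp ℓ q ≡ true
  good⇒opp {q = zero} c g m≢0 q≢0 = contradiction refl q≢0
  good⇒opp {q = suc q} c g m≢0 q≢0 = ¬-not λ o → true≢false (mult≢0⇒bad ℓ c o m≢0) g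

  good⇒even : ∀ {q} (c : Vec ℕ k) → bad ℓ c q ≡ false → opp ℓ q ≡ true → odd (mult q c) ≡ false
  good⇒even c g o = trans (sym (bad-opp ℓ c o)) g

  unmatched⇔shape : (c : Vec ℕ k) → Mmatch ℓ c ≡ nothing ⇔ UnmatchedShape ℓ c
  unmatched⇔shape {k} c = mk⇔ to from
    where
    to : Mmatch ℓ c ≡ nothing → UnmatchedShape ℓ c
    to e with Mmatch ℓ c | classify ℓ c
    ... | _ | critical g = part , λ o → even%2 {mult 0 c} (good⇒even c (g 0) (%2-odd {ℓ} o))
      where
      part : ∀ i → lookup c i ≢ 0 → (mult (lookup c i) c % 2 ≡ 0) × (lookup c i % 2 ≢ ℓ % 2)
      part i x≢0 = even%2 {mult (lookup c i) c} (good⇒even c (g (lookup c i)) o) , opp⇒%2≢ {lookup c i} o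
        where
        o = good⇒opp c (g (lookup c i)) (mult-lookup c i) x≢0
    from : UnmatchedShape ℓ c → Mmatch ℓ c ≡ nothing
    from (part , zeros) with Mmatch ℓ c | classify ℓ c
    ... | _ | critical _ = refl
    ... | _ | upper p ((b , _) , o) with mult≢0⇒lookup (suc p) c (bad⇒mult≢0 ℓ c b)
    ...   | i , eq = contradiction (trans (cong (_% 2) eq) (same⇒%2≡ {suc p} (opp-suc-false ℓ p o)))
                       (proj₂ (part i (λ x≡0 → 1+n≢0 (trans (sym eq) x≡0))))
    -- Here `0` has parity opposite to `ℓ`, so `ℓ` is odd and the condition on zeros applies.
    from (part , zeros) | _ | lower zero ((b , _) , o) =
      contradiction (trans (sym (odd%2 {mult 0 c} (trans (sym (bad-opp ℓ c o)) b))) (zeros (odd%2 {ℓ} o))) λ ()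
    from (part , zeros) | _ | lower (suc p) ((b , _) , o) with mult≢0⇒lookup (suc p) c (bad⇒mult≢0 ℓ c b)
    ...   | i , eq with proj₁ (part i (λ x≡0 → 1+n≢0 (trans (sym eq) x≡0)))
    ...     | even rewrite eq =
      contradiction (trans (sym (odd%2 {mult (suc p) c} (trans (sym (bad-opp ℓ c o)) b))) even) λ ()

  -- A rank that decreases along directed paths.

  upper? : (c : Vec ℕ k) → Dec (∃ λ p → Upper ℓ p c)
  upper? c with Mmatch ℓ c | classify ℓ c
  ... | _ | upper p u = yes (p , u)
  ... | _ | lower p l = no λ (_ , u) → lower∧upper ℓ c l u
  ... | _ | critical g = no λ (p , (b , _) , _) → true≢false b (g (suc p))

  -- Zeros count only when ℓ is even: then 0 has the parity of ℓ without being a candidate for A(c).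
  freeZeros : Vec ℕ k → ℕ
  freeZeros c = if opp ℓ 0 then 0 else mult 0 c

  -- First the size of the lower end of the matched pair (for a critical element, its own size),
  -- then the zeros that count. The last entry makes the step from a lower element up to its partner
  -- a descent.
  rank : Vec ℕ k → ℕ × ℕ × ℕ
  rank c with upper? c
  ... | yes _ = size c ∸ 1 , freeZeros c , 0
  ... | no  _ = size c     , freeZeros c , 1

  rank-upper : ∀ {p} (c : Vec ℕ k) → Upper ℓ p c → rank c ≡ (size c ∸ 1 , freeZeros c , 0)
  rank-upper c u with upper? c
  ... | yes _ = refl
  ... | no ¬u = contradiction (_ , u) ¬u

  rank-lower : ∀ {p} (c : Vec ℕ k) → Lower ℓ p c → rank c ≡ (size c , freeZeros c , 1)
  rank-lower c l with upper? c
  ... | yes (_ , u) = ⊥-elim (lower∧upper ℓ c l u)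
  ... | no _ = refl

  -- Raising a `0` of parity opposite to `ℓ` means that `ℓ` is odd, where zeros are not counted;
  -- raising a positive part leaves the zeros alone.
  freeZeros-inc : ∀ {p} {c d : Vec ℕ k} → Inc p c d → opp ℓ p ≡ true → freeZeros c ≡ freeZeros d
  freeZeros-inc {p = zero} i o rewrite o = refl
  freeZeros-inc {p = suc p} i o = cong (λ m → if opp ℓ 0 then 0 else m) (inc-mult-< i (s≤s z≤n))

infix 4 _≺_
-- The middle component is reversed because zeros accumulate along a path. Asymmetry suffices to
-- exclude closed paths.
_≺_ : ℕ × ℕ × ℕ → ℕ × ℕ × ℕ → Set
_≺_ = ×-Lex _≡_ _<_ (×-Lex _≡_ _>_ _<_)

≺-trans : Transitive _≺_
≺-trans = ×-transitive {_<₂_ = ×-Lex _≡_ _>_ _<_} isEquivalence (resp₂ _<_) <-trans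
  (×-transitive {_<₂_ = _<_} isEquivalence (resp₂ _>_) (λ p q → <-trans q p) <-trans)

≺-asym : Asymmetric _≺_
≺-asym = ×-asymmetric {_<₂_ = ×-Lex _≡_ _>_ _<_} sym (resp₂ _<_) <-asym
  (×-asymmetric {_<₂_ = _<_} sym (resp₂ _>_) <-asym <-asym)

module _ (ℓ : ℕ) where

  -- An unmatched covering relation below an upper element leads again to an upper element,
  -- unless it lowers a part 1 to 0 and ℓ is even.
  freeZeros-down : ∀ {p a} {c d : Vec ℕ k} → IsPart k ℓ c → IsPart k ℓ d → Inc p c d → Mmatch ℓ d ≢ just c →
    Upper ℓ a d → ¬ (∃ λ q → Upper ℓ q c) → freeZeros ℓ d < freeZeros ℓ c
  freeZeros-down {p = p} {a} {c} {d} (_ , sc) (_ , sd) i ≢M u@((b , g) , oa) ¬u with <-cmp p a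
  -- Raising `a` in `c` would make `c` the partner of `d`.
  ... | tri≈ _ refl _ = contradiction
          (trans (Mmatch-upper ℓ d u) (cong just
            (sorted-≈⇒≡ (decLast-sorted p d sd) sc (inc-inj (upper-Inc ℓ d u) i (λ _ → refl))))) ≢M
  -- The change takes place above `a`: `suc a` still occurs in `c` and smaller values are unchanged,
  -- so `c` is upper with the same index.
  ... | tri> _ _ a<p = ⊥-elim (¬u (a , (mult≢0⇒bad ℓ c (opp-suc-false ℓ a oa) a∈c ,
          λ r<1+a → trans (bad-cong ℓ {c = c} {d} (inc-mult-< i (<-≤-trans r<1+a a<p))) (g r<1+a)) , oa))
    where
    a∈c : mult (suc a) c ≢ 0
    a∈c with m≤n⇒m<n∨m≡n a<p
    ... | inj₁ 1+a<p = subst (_≢ 0) (sym (inc-mult-< i 1+a<p)) (bad⇒mult≢0 ℓ d b)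
    ... | inj₂ refl rewrite inc-mult-lo i = λ ()
  ... | tri< p<a _ _ with opp ℓ p in op
  -- The part `suc p` of `d` would have the parity of `ℓ` and be a bad value below `suc a`.
  ...   | true = contradiction (g (s≤s p<a)) (true≢false (mult≢0⇒bad ℓ d (opp-suc-false ℓ p op) p∈d))
    where
    p∈d : mult (suc p) d ≢ 0
    p∈d rewrite inc-mult-hi i = λ ()
  ...   | false = lowered p i op p<a
    where
    lowered : ∀ p → Inc p c d → opp ℓ p ≡ false → p < a → freeZeros ℓ d < freeZeros ℓ c
    lowered zero i op p<a rewrite op | inc-mult-lo i = ≤-refl
    -- The nonzero part that is raised has the parity of `ℓ`, so it is the first bad value of `c`
    -- and makes `c` upper.
    lowered (suc p) i op p<a = ⊥-elim (¬u (p , (mult≢0⇒bad ℓ c op p∈c ,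
      λ r<1+p → trans (bad-cong ℓ {c = c} {d} (inc-mult-< i r<1+p)) (g (<-trans r<1+p (m<n⇒m<1+n p<a)))) ,
      not-injective (trans (sym (opp-suc ℓ p)) op)))
      where
      p∈c : mult (suc p) c ≢ 0
      p∈c rewrite inc-mult-lo i = λ ()

  matched-upper : (c d : Vec ℕ k) → c ⋖ d → Mmatch ℓ d ≡ just c → ∃ λ p → Upper ℓ p d × Inc p c d
  matched-upper c d c⋖d eq with Mmatch ℓ d | classify ℓ d
  matched-upper _ d c⋖d refl | _ | upper p u = p , u , upper-Inc ℓ d u
  matched-upper _ d c⋖d refl | _ | lower p l =
    contradiction (trans (proj₂ c⋖d) (cong suc (inc-size (lower-Inc ℓ d l)))) (<⇒≢ (m<n⇒m<1+n ≤-refl))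

  edge-≺ : {c d : Vec ℕ k} → MEdge k ℓ c d → rank ℓ d ≺ rank ℓ c
  edge-≺ {c = d} {c} (down pd pc c⋖d ≢M) with ⋖⇒inc c d c⋖d
  ... | p , i with upper? ℓ d | upper? ℓ c
  -- Being upper, the target has positive size, so the truncated subtraction in its rank really
  -- subtracts one.
  ...   | yes _ | yes (_ , u) rewrite inc-size i | inc-size (upper-Inc ℓ c u) = inj₁ ≤-refl
  ...   | yes (_ , u) | no ¬u rewrite inc-size i = inj₂ (refl , inj₁ (freeZeros-down pc pd i ≢M u ¬u))
  ...   | no _ | yes _ rewrite inc-size i = inj₁ (s≤s (m∸n≤m (size c) 1))
  ...   | no _ | no _ rewrite inc-size i = inj₁ ≤-refl
  edge-≺ {c = c} {d} (up pd pc c⋖d eq) with matched-upper c d c⋖d eq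
  ... | p , u , i
    rewrite rank-upper ℓ d u | rank-lower ℓ c (lower-inc ℓ i u) | freeZeros-inc ℓ i (proj₂ u) | inc-size i =
    inj₂ (refl , inj₂ (refl , ≤-refl))

  path-≺ : {c d : Vec ℕ k} → TransClosure (MEdge k ℓ) c d → rank ℓ d ≺ rank ℓ c
  path-≺ [ e ] = edge-≺ e
  path-≺ (e ∷ es) = ≺-trans (path-≺ es) (edge-≺ e)

  isAcyclic : IsAcyclic k ℓ
  isAcyclic c cyc = ≺-asym (path-≺ cyc) (path-≺ cyc)

-- The boundary on symmetric functions of the row sizes

xor-cancel : ∀ {a b} → a xor b ≡ false → a ≡ b
xor-cancel {true} {true} _ = refl
xor-cancel {false} {false} _ = refl

∧-cong-guard : ∀ b {x y} → (b ≡ true → x ≡ y) → b ∧ x ≡ b ∧ y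
∧-cong-guard true e = e refl
∧-cong-guard false _ = refl

sumᵇ : ∀ {A : Set} → (A → Bool) → Vec A k → Bool
sumᵇ χ [] = false
sumᵇ χ (x ∷ xs) = χ x xor sumᵇ χ xs

sumᵇ-xor : ∀ (φ ψ : ℕ → Bool) (c : Vec ℕ k) → sumᵇ (λ x → φ x xor ψ x) c ≡ sumᵇ φ c xor sumᵇ ψ c
sumᵇ-xor φ ψ [] = refl
sumᵇ-xor φ ψ (x ∷ c) = trans (cong ((φ x xor ψ x) xor_) (sumᵇ-xor φ ψ c)) (xor-interchange (φ x) (ψ x) (sumᵇ φ c) (sumᵇ ψ c))

sumᵇ-inc : ∀ {p} χ {c d : Vec ℕ k} → Inc p c d → χ p xor sumᵇ χ d ≡ χ (suc p) xor sumᵇ χ c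
sumᵇ-inc {p = p} χ (here {c = c}) = xor-swapˡ (χ p) (χ (suc p)) (sumᵇ χ c)
sumᵇ-inc {p = p} χ (there {x = x} {c} {d} i) = begin
  χ p xor (χ x xor sumᵇ χ d)       ≡⟨ xor-swapˡ (χ p) (χ x) (sumᵇ χ d) ⟩
  χ x xor (χ p xor sumᵇ χ d)       ≡⟨ cong (χ x xor_) (sumᵇ-inc χ i) ⟩
  χ x xor (χ (suc p) xor sumᵇ χ c) ≡⟨ xor-swapˡ (χ x) (χ (suc p)) (sumᵇ χ c) ⟩
  χ (suc p) xor (χ x xor sumᵇ χ c) ∎
  where open ≡-Reasoning

rangeSum : ℕ → (ℕ → Bool) → Bool
rangeSum zero g = false
rangeSum (suc n) g = g n xor rangeSum n g

rangeSum-cong : ∀ n {g h : ℕ → Bool} → (∀ q → g q ≡ h q) → rangeSum n g ≡ rangeSum n h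
rangeSum-cong zero e = refl
rangeSum-cong (suc n) e = cong₂ _xor_ (e n) (rangeSum-cong n e)

rangeSum-xor : ∀ n (g h : ℕ → Bool) → rangeSum n (λ q → g q xor h q) ≡ rangeSum n g xor rangeSum n h
rangeSum-xor zero g h = refl
rangeSum-xor (suc n) g h = trans (cong ((g n xor h n) xor_) (rangeSum-xor n g h))
  (xor-interchange (g n) (h n) (rangeSum n g) (rangeSum n h))

rangeSum-zero : ∀ n {g : ℕ → Bool} → (∀ q → q < n → g q ≡ false) → rangeSum n g ≡ false
rangeSum-zero zero e = refl
rangeSum-zero (suc n) e rewrite e n ≤-refl = rangeSum-zero n (λ q q<n → e q (m<n⇒m<1+n q<n))

rangeSum-point : ∀ n x (χ : ℕ → Bool) → x < n → rangeSum n (λ q → (x ≡ᵇ q) ∧ χ q) ≡ χ x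
rangeSum-point (suc n) x χ x<1+n with m≤n⇒m<n∨m≡n (s≤s⁻¹ x<1+n)
... | inj₁ x<n rewrite ≢⇒≡ᵇ (<⇒≢ x<n) = rangeSum-point n x χ x<n
... | inj₂ refl rewrite ≡ᵇ-refl x
  | rangeSum-zero n {λ q → (x ≡ᵇ q) ∧ χ q} (λ q q<n → cong (_∧ χ q) (≢⇒≡ᵇ (>⇒≢ q<n))) = xor-identityʳ (χ x)

odd-mult-∷ : ∀ q x (c : Vec ℕ k) → odd (mult q (x ∷ c)) ≡ (x ≡ᵇ q) xor odd (mult q c)
odd-mult-∷ q x c with x ≡ᵇ q
... | true = refl
... | false = refl

-- Grouping entries by value: modulo 2 a value contributes only through the parity of its
-- multiplicity.
sumᵇ-range : ∀ n χ (c : Vec ℕ k) → (∀ i → lookup c i < n) → sumᵇ χ c ≡ rangeSum n (λ q → odd (mult q c) ∧ χ q)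
sumᵇ-range n χ [] _ = sym (rangeSum-zero n λ _ _ → refl)
sumᵇ-range n χ (x ∷ c) lt = sym (begin
  rangeSum n (λ q → odd (mult q (x ∷ c)) ∧ χ q)
    ≡⟨ rangeSum-cong n (λ q → trans (cong (_∧ χ q) (odd-mult-∷ q x c)) (∧-distribʳ-xor (χ q) (x ≡ᵇ q) (odd (mult q c)))) ⟩
  rangeSum n (λ q → ((x ≡ᵇ q) ∧ χ q) xor (odd (mult q c) ∧ χ q))
    ≡⟨ rangeSum-xor n (λ q → (x ≡ᵇ q) ∧ χ q) (λ q → odd (mult q c) ∧ χ q) ⟩
  rangeSum n (λ q → (x ≡ᵇ q) ∧ χ q) xor rangeSum n (λ q → odd (mult q c) ∧ χ q)
    ≡⟨ cong₂ _xor_ (rangeSum-point n x χ (lt zero)) (sym (sumᵇ-range n χ c (lt ∘ suc))) ⟩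
  χ x xor sumᵇ χ c ∎)
  where open ≡-Reasoning

lookup≤size : (c : Vec ℕ k) → ∀ i → lookup c i ≤ size c
lookup≤size (x ∷ c) zero = m≤m+n x (size c)
lookup≤size (x ∷ c) (suc i) = ≤-trans (lookup≤size c i) (m≤n+m (size c) x)

sumᵇ-odd : ∀ χ (c : Vec ℕ k) → (∀ q → odd (mult q c) ≡ true → χ q ≡ false) → sumᵇ χ c ≡ false
sumᵇ-odd χ c e = trans (sumᵇ-range (suc (size c)) χ c (s≤s ∘ lookup≤size c)) (rangeSum-zero (suc (size c)) λ q _ → term q)
  where
  term : ∀ q → odd (mult q c) ∧ χ q ≡ false
  term q with odd (mult q c) | e q
  ... | true | e′ = e′ refl
  ... | false | _ = refl

sumᵇ-cong-odd : ∀ φ ψ (c : Vec ℕ k) → (∀ q → odd (mult q c) ≡ true → φ q ≡ ψ q) → sumᵇ φ c ≡ sumᵇ ψ c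
sumᵇ-cong-odd φ ψ c e = xor-cancel (trans (sym (sumᵇ-xor φ ψ c)) (sumᵇ-odd (λ x → φ x xor ψ x) c
  λ q o → trans (cong (_xor ψ q) (e q o)) (xor-same (ψ q))))

sumᵇ-point : ∀ p y (c : Vec ℕ k) → sumᵇ (λ x → (x ≡ᵇ p) ∧ y) c ≡ odd (mult p c) ∧ y
sumᵇ-point p y [] = refl
sumᵇ-point p y (x ∷ c) rewrite odd-mult-∷ p x c | sumᵇ-point p y c = sym (∧-distribʳ-xor y (x ≡ᵇ p) (odd (mult p c)))

sumᵇ-parity : (c : Vec ℕ k) → sumᵇ odd c ≡ odd (size c)
sumᵇ-parity [] = refl
sumᵇ-parity (x ∷ c) = trans (cong (odd x xor_) (sumᵇ-parity c)) (sym (odd-+ x (size c)))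

-- Raising `p` and raising `q` commute on multisets, so undoing the `p`-raise in `e` leaves just the
-- `q`-raise of `a`.
inc-diamond : ∀ {p q} {a b c d e : Vec ℕ k} → Inc p a b → Inc q b e → Inc q a c → Inc p d e → d ≈ c
inc-diamond {p = p} {q} {a} {b} {c} {d} {e} ab be ac de r =
  +-cancelˡ-≡ Q _ _ (+-cancelˡ-≡ P′ _ _ (begin
    P′ + (Q + mult r d)  ≡⟨ x∙yz≈y∙xz P′ Q _ ⟩
    Q + (P′ + mult r d)  ≡⟨ cong (Q +_) (inc-mult de r) ⟨
    Q + (P + mult r e)   ≡⟨ x∙yz≈y∙xz Q P _ ⟩
    P + (Q + mult r e)   ≡⟨ cong (P +_) (inc-mult be r) ⟩
    P + (Q′ + mult r b)  ≡⟨ x∙yz≈y∙xz P Q′ _ ⟩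
    Q′ + (P + mult r b)  ≡⟨ cong (Q′ +_) (inc-mult ab r) ⟩
    Q′ + (P′ + mult r a) ≡⟨ x∙yz≈y∙xz Q′ P′ _ ⟩
    P′ + (Q′ + mult r a) ≡⟨ cong (P′ +_) (inc-mult ac r) ⟨
    P′ + (Q + mult r c)  ∎))
  where
  open ≡-Reasoning
  P = bit (p ≡ᵇ r)
  P′ = bit (suc p ≡ᵇ r)
  Q = bit (q ≡ᵇ r)
  Q′ = bit (suc q ≡ᵇ r)

-- The contracting homotopy given by the matching.

Symmetric : (Vec ℕ k → Bool) → Set
Symmetric f = ∀ c d → c ≈ d → f c ≡ f d

module _ (ℓ : ℕ) where

  -- The coefficient of `D` at an orbit: a row with `x` boxes can be enlarged in `ℓ - x` ways, a
  -- number whose parity is `opp ℓ x`.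
  boundary : (Vec ℕ k → Bool) → Vec ℕ k → Bool
  boundary f c = sumᵇ (λ x → opp ℓ x ∧ f (incFirst x c)) c

  -- Transposed to coefficients: the homotopy sends each lower element to its partner.
  homotopy : (Vec ℕ k → Bool) → Vec ℕ k → Bool
  homotopy f c with upper? ℓ c
  ... | yes (p , _) = f (decLast (suc p) c)
  ... | no _ = false

  homotopy-upper : ∀ {p} (f : Vec ℕ k → Bool) (c : Vec ℕ k) → Upper ℓ p c → homotopy f c ≡ f (decLast (suc p) c)
  homotopy-upper f c u with upper? ℓ c
  ... | yes (q , u′) = cong (λ a → f (decLast a c)) (firstBad-unique ℓ c (proj₁ u′) (proj₁ u))
  ... | no ¬u = contradiction (_ , u) ¬u

  homotopy-lower : ∀ {p} (f : Vec ℕ k → Bool) (c : Vec ℕ k) → Lower ℓ p c → homotopy f c ≡ false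
  homotopy-lower f c l with upper? ℓ c
  ... | yes (_ , u) = ⊥-elim (lower∧upper ℓ c l u)
  ... | no _ = refl

  upper-cong : ∀ {p} (c d : Vec ℕ k) → c ≈ d → Upper ℓ p c → Upper ℓ p d
  upper-cong c d e (fb , o) = firstBad-cong ℓ {c = c} {d} (λ {q} _ → e q) fb , o

  homotopy-symmetric : (f : Vec ℕ k → Bool) → Symmetric f → Symmetric (homotopy f)
  homotopy-symmetric f fs c d e with upper? ℓ c
  ... | yes (p , u) = trans
          (fs _ _ (inc-inj (upper-Inc ℓ c u) (upper-Inc ℓ d u′) e))
          (sym (homotopy-upper f d u′))
    where u′ = upper-cong c d e u
  ... | no ¬u with upper? ℓ d
  ...   | yes (p , u) = contradiction (p , upper-cong d c (≈-sym {c = c} {d} e) u) ¬u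
  ...   | no _ = refl

  firstBad-≤ : ∀ {p q} (c : Vec ℕ k) → FirstBad ℓ c p → opp ℓ q ≡ true → odd (mult q c) ≡ true → p ≤ q
  firstBad-≤ c (_ , g) o m = ≮⇒≥ λ q<p → true≢false m (good⇒even ℓ c (g q<p) o)

  -- Equal nonzero parts pair off; only `0` may have odd multiplicity.
  critical⇒even : (c : Vec ℕ k) → (∀ q → bad ℓ c q ≡ false) → odd (size c) ≡ false
  critical⇒even c g = trans (sym (sumᵇ-parity c)) (sumᵇ-odd odd c part)
    where
    part : ∀ q → odd (mult q c) ≡ true → odd q ≡ false
    part zero _ = refl
    part (suc q) m = contradiction (good⇒even ℓ c (g (suc q)) (good⇒opp ℓ c (g (suc q)) (odd⇒≢0 m) λ ())) (true≢false m)

  -- The homotopy formula for a cycle vanishing on critical elements. The cycle condition is asked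
  -- only below `c`, where parts stay bounded by `ℓ` once those of `c` are.
  boundary-homotopy : (f : Vec ℕ k → Bool) (c : Vec ℕ k) → Symmetric f →
    (∀ d → d ⊑ c → boundary f d ≡ false) →
    ((∀ q → bad ℓ c q ≡ false) → f c ≡ false) →
    boundary (homotopy f) c ≡ f c
  boundary-homotopy f c fs cycle crit with Mmatch ℓ c | classify ℓ c
  -- No value of parity opposite to `ℓ` has odd multiplicity, so every term of the boundary cancels.
  ... | _ | critical g = trans (sumᵇ-odd _ c λ q m →
          cong (_∧ homotopy f (incFirst q c)) (¬-not λ o → true≢false m (good⇒even ℓ c (g q) o)))
          (sym (crit g))
  -- Raising `p` reaches the partner, whose homotopy value is `f c`. Raising a larger `q` keeps `p`
  -- as first bad value, so the result is lower and contributes nothing.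
  ... | _ | lower p l = trans (sumᵇ-cong-odd _ (λ x → (x ≡ᵇ p) ∧ f c) c term)
          (trans (sumᵇ-point p (f c) c) (cong (_∧ f c) (trans (sym (bad-opp ℓ c (proj₂ l))) (proj₁ (proj₁ l)))))
    where
    term : ∀ q → odd (mult q c) ≡ true → opp ℓ q ∧ homotopy f (incFirst q c) ≡ (q ≡ᵇ p) ∧ f c
    term q m with q ≡ᵇ p | ≡ᵇ-reflects q p
    ... | true | ofʸ refl = trans (cong (_∧ homotopy f (incFirst q c)) (proj₂ l))
            (trans (homotopy-upper f (incFirst q c) u) (fs _ _ (inc-inj (upper-Inc ℓ (incFirst q c) u) i (λ _ → refl))))
      where
      i = lower-Inc ℓ c l
      u = upper-inc ℓ i l
    ... | false | ofⁿ q≢p = trans (∧-cong-guard (opp ℓ q) vanish) (∧-zeroʳ (opp ℓ q))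
      where
      vanish : opp ℓ q ≡ true → homotopy f (incFirst q c) ≡ false
      vanish o = homotopy-lower f (incFirst q c)
        (firstBad-cong ℓ {c = c} {incFirst q c} (λ r≤p → inc-mult-< i (≤-<-trans r≤p p<q)) (proj₁ l) , proj₂ l)
        where
        p<q = ≤∧≢⇒< (firstBad-≤ c (proj₁ l) o m) (q≢p ∘ sym)
        i = incFirst-Inc q c (odd⇒≢0 m)
  -- Raising some `q` above `suc p` keeps the element upper, which turns the sum into the terms of
  -- the boundary at the partner `c′`. That boundary vanishes, and exchanging `suc p` for `p` leaves
  -- the single term `ψ p`, which is `f c`.
  ... | _ | upper p u = begin
    boundary (homotopy f) c                 ≡⟨ sumᵇ-cong-odd _ ψ c (λ q m → ∧-cong-guard (opp ℓ q) (term q m)) ⟩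
    sumᵇ ψ c                                ≡⟨ xor-cancel {ψ p} (trans (sumᵇ-inc ψ i) (cong₂ _xor_ ψ[1+p] (cycle c′ (decLast-⊑ p c)))) ⟨
    ψ p                                     ≡⟨ cong (_∧ f (incFirst p c′)) o ⟩
    f (incFirst p c′)                       ≡⟨ fs _ _ (inc-det (lower-Inc ℓ c′ (lower-inc ℓ i u)) i (λ _ → refl)) ⟩
    f c                                     ∎
    where
    open ≡-Reasoning
    o = proj₂ u
    c′ = decLast (suc p) c
    i = upper-Inc ℓ c u
    ψ : ℕ → Bool
    ψ x = opp ℓ x ∧ f (incFirst x c′)
    ψ[1+p] : ψ (suc p) ≡ false
    ψ[1+p] = cong (_∧ f (incFirst (suc p) c′)) (opp-suc-false ℓ p o)
    term : ∀ q → odd (mult q c) ≡ true → opp ℓ q ≡ true → homotopy f (incFirst q c) ≡ f (incFirst q c′)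
    term q m oq = trans (homotopy-upper f e ue) (fs _ _ (inc-diamond i ce (incFirst-Inc q c′ q∈c′) (upper-Inc ℓ e ue)))
      where
      e = incFirst q c
      ce = incFirst-Inc q c (odd⇒≢0 m)
      p<q = ≤∧≢⇒< (firstBad-≤ c (proj₁ u) oq m) λ { refl → true≢false oq (opp-suc-false ℓ p o) }
      ue : Upper ℓ p e
      ue = firstBad-cong ℓ {c = c} {e} (λ r≤p → inc-mult-< ce (≤-<-trans r≤p p<q)) (proj₁ u) , o
      q∈c′ : mult q c′ ≢ 0
      q∈c′ = subst (_≢ 0) (sym (inc-mult-≢ i (<⇒≢ (<-trans (n<1+n p) p<q)) (<⇒≢ p<q))) (odd⇒≢0 m)

-- Orbits of subsets

lookup-removeAt : ∀ {A : Set} (c : Vec A (suc k)) j i → lookup (removeAt c j) i ≡ lookup c (punchIn j i)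
lookup-removeAt (x ∷ c) zero i = refl
lookup-removeAt (x ∷ y ∷ c) (suc j) zero = refl
lookup-removeAt (x ∷ y ∷ c) (suc j) (suc i) = lookup-removeAt (y ∷ c) j i

mult-removeAt : ∀ q (c : Vec ℕ (suc k)) j → mult q c ≡ mult q (lookup c j ∷ removeAt c j)
mult-removeAt q (x ∷ c) zero = refl
mult-removeAt q (x ∷ c@(_ ∷ _)) (suc j) = begin
  mult q (x ∷ c)           ≡⟨ mult-∷ q x c ⟩
  X + mult q c             ≡⟨ cong (X +_) (trans (mult-removeAt q c j) (mult-∷ q z c′)) ⟩
  X + (Z + mult q c′)      ≡⟨ x∙yz≈y∙xz X Z (mult q c′) ⟩
  Z + (X + mult q c′)      ≡⟨ trans (mult-∷ q z (x ∷ c′)) (cong (Z +_) (mult-∷ q x c′)) ⟨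
  mult q (z ∷ x ∷ c′)      ∎
  where
  open ≡-Reasoning
  z = lookup c j
  c′ = removeAt c j
  X = bit (x ≡ᵇ q)
  Z = bit (z ≡ᵇ q)

-- The head of `c` is sent to one of its occurrences in `d`; both are deleted and the rest follows
-- by induction.
≈⇒permutation : (c d : Vec ℕ k) → c ≈ d → Σ (Permutation k k) λ π → ∀ i → lookup d (π ⟨$⟩ʳ i) ≡ lookup c i
≈⇒permutation [] [] _ = Perm.id , λ ()
≈⇒permutation {suc k} (x ∷ c) d e with mult≢0⇒lookup x d (subst (_≢ 0) (e x) (mult-lookup (x ∷ c) zero))
... | j , refl with ≈⇒permutation c (removeAt d j)
                      (≈-tail (lookup d j) {c} {removeAt d j} λ q → trans (e q) (mult-removeAt q d j))
... | π , eq = π′ , λ { zero → refl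
                      ; (suc i) → trans (cong (lookup d) (insert-punchIn zero j π i))
                                        (trans (sym (lookup-removeAt d j (π ⟨$⟩ʳ i))) (eq i)) }
  where
  π′ = insert zero j π

mult-sum : ∀ q (c : Vec ℕ k) → mult q c ≡ sum (λ i → bit (lookup c i ≡ᵇ q))
mult-sum q [] = refl
mult-sum q (x ∷ c) = trans (mult-∷ q x c) (cong (bit (x ≡ᵇ q) +_) (mult-sum q c))

permutation⇒≈ : (c d : Vec ℕ k) (π : Permutation k k) → (∀ i → lookup d i ≡ lookup c (π ⟨$⟩ʳ i)) → d ≈ c
permutation⇒≈ c d π e q = begin
  mult q d                                    ≡⟨ mult-sum q d ⟩
  sum (λ i → bit (lookup d i ≡ᵇ q))           ≡⟨ sum-cong-≗ (λ i → cong (λ x → bit (x ≡ᵇ q)) (e i)) ⟩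
  sum (λ i → bit (lookup c (π ⟨$⟩ʳ i) ≡ᵇ q))  ≡⟨ sum-permute (λ i → bit (lookup c i ≡ᵇ q)) π ⟨
  sum (λ i → bit (lookup c i ≡ᵇ q))           ≡⟨ mult-sum q c ⟨
  mult q c                                    ∎
  where open ≡-Reasoning

count : Vec Bool ℓ → ℕ
count r = boolCount (toList r)

counts : Sub k ℓ → Vec ℕ k
counts = map count

count≤ : (r : Vec Bool ℓ) → count r ≤ ℓ
count≤ [] = z≤n
count≤ (true ∷ r) = s≤s (count≤ r)
count≤ (false ∷ r) = m≤n⇒m≤1+n (count≤ r)

count-sum : (r : Vec Bool ℓ) → count r ≡ sum (λ j → bit (lookup r j))
count-sum [] = refl
count-sum (true ∷ r) = cong suc (count-sum r)
count-sum (false ∷ r) = count-sum r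

count-permutation : (r s : Vec Bool ℓ) (σ : Permutation ℓ ℓ) → (∀ j → lookup s j ≡ lookup r (σ ⟨$⟩ʳ j)) → count s ≡ count r
count-permutation r s σ e = trans (count-sum s) (trans (sum-cong-≗ (λ j → cong bit (e j)))
  (trans (sym (sum-permute (bit ∘ lookup r) σ)) (sym (count-sum r))))

-- Rows are encoded as 0/1 vectors, so that `≈⇒permutation` also provides permutations within a row;
-- the number of ones and the length determine all multiplicities.
count-bits : (r s : Vec Bool ℓ) → count r ≡ count s → map bit r ≈ map bit s
count-bits r s e zero = +-cancelˡ-≡ (count r) _ _
  (trans (total r) (trans (sym (total s)) (cong (_+ mult 0 (map bit s)) (sym e))))
  where
  total : ∀ {ℓ} (r : Vec Bool ℓ) → count r + mult 0 (map bit r) ≡ ℓ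
  total [] = refl
  total (true ∷ r) = cong suc (total r)
  total (false ∷ r) = trans (+-suc (count r) _) (cong suc (total r))
count-bits r s e (suc zero) = trans (ones r) (trans e (sym (ones s)))
  where
  ones : ∀ {ℓ} (r : Vec Bool ℓ) → mult 1 (map bit r) ≡ count r
  ones [] = refl
  ones (true ∷ r) = cong suc (ones r)
  ones (false ∷ r) = ones r
count-bits r s e (suc (suc q)) = trans (other r) (sym (other s))
  where
  other : ∀ {ℓ} (r : Vec Bool ℓ) → mult (suc (suc q)) (map bit r) ≡ 0
  other [] = refl
  other (true ∷ r) = other r
  other (false ∷ r) = other r

bit-injective : ∀ {a b} → bit a ≡ bit b → a ≡ b
bit-injective {true} {true} _ = refl
bit-injective {false} {false} _ = refl

row-permutation : (r s : Vec Bool ℓ) → count r ≡ count s →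
  Σ (Permutation ℓ ℓ) λ σ → ∀ j → lookup s (σ ⟨$⟩ʳ j) ≡ lookup r j
row-permutation r s e with ≈⇒permutation (map bit r) (map bit s) (count-bits r s e)
... | σ , eq = σ , λ j → bit-injective (trans (sym (lookup-map (σ ⟨$⟩ʳ j) bit s)) (trans (eq j) (lookup-map j bit r)))

wreath : Permutation k k → (Fin k → Permutation ℓ ℓ) → Box k ℓ ↔ Box k ℓ
wreath π σ = mk↔ₛ′
  (λ (i , j) → π ⟨$⟩ʳ i , σ i ⟨$⟩ʳ j)
  (λ (i , j) → π ⟨$⟩ˡ i , σ (π ⟨$⟩ˡ i) ⟨$⟩ˡ j)
  (λ (i , j) → cong₂ _,_ (inverseʳ π) (inverseʳ (σ (π ⟨$⟩ˡ i))))
  (λ (i , j) → trans (cong (λ i′ → i′ , σ i′ ⟨$⟩ˡ (σ i ⟨$⟩ʳ j)) (inverseˡ π)) (cong (i ,_) (inverseˡ (σ i))))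

wreath-InG : (π : Permutation k k) (σ : Fin k → Permutation ℓ ℓ) → InG (wreath π σ)
wreath-InG π σ = (λ _ _ → cong (π ⟨$⟩ʳ_)) , (λ _ _ → cong (π ⟨$⟩ˡ_))

-- The two subsets lie in one orbit: each row of `S` is rearranged into the row of `S′` assigned to
-- it by `π`, and these moves form one element of the wreath product.
invariant⇒rows : (v : Chain k ℓ) → Invariant v → (S S′ : Sub k ℓ) (π : Permutation k k) →
  (∀ i → count (lookup S i) ≡ count (lookup S′ (π ⟨$⟩ʳ i))) → v S′ ≡ v S
invariant⇒rows v inv S S′ π e = trans (cong v (sym moved)) (inv (wreath π σ) (wreath-InG π σ) S)
  where
  open ≡-Reasoning
  row : ∀ i → _
  row i = row-permutation (lookup S i) (lookup S′ (π ⟨$⟩ʳ i)) (e i)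
  σ : _
  σ i = proj₁ (row i)
  entry : ∀ i j → lookup (lookup S (π ⟨$⟩ˡ i)) (σ (π ⟨$⟩ˡ i) ⟨$⟩ˡ j) ≡ lookup (lookup S′ i) j
  entry i j = begin
    lookup (lookup S i′) j′                             ≡⟨ proj₂ (row i′) j′ ⟨
    lookup (lookup S′ (π ⟨$⟩ʳ i′)) (σ i′ ⟨$⟩ʳ j′)       ≡⟨ cong₂ (λ a b → lookup (lookup S′ a) b) (inverseʳ π) (inverseʳ (σ i′)) ⟩
    lookup (lookup S′ i) j                              ∎
    where
    i′ = π ⟨$⟩ˡ i
    j′ = σ i′ ⟨$⟩ˡ j
  moved : actS (wreath π σ) S ≡ S′
  moved = trans (tabulate-cong (λ i → trans (tabulate-cong (entry i)) (tabulate∘lookup (lookup S′ i)))) (tabulate∘lookup S′)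

-- Conversely, an element of `G` preserves the multiset of row sizes. The column `j₀` provides a box
-- in each row from which the row permutation is read off; `from` is used because `actS` pulls back
-- along it.
module _ (g : Box k ℓ ↔ Box k ℓ) (g∈G : InG g) (j₀ : Fin ℓ) where
  private
    to = Inverse.to g
    from = Inverse.from g
    to∘from : ∀ x → to (from x) ≡ x
    to∘from = Inverse.strictlyInverseˡ g
    from∘to : ∀ x → from (to x) ≡ x
    from∘to = Inverse.strictlyInverseʳ g

  rowMap : Permutation k k
  rowMap = permutation (λ i → proj₁ (from (i , j₀))) (λ i → proj₁ (to (i , j₀)))
    (λ i → trans (proj₂ g∈G _ _ refl) (cong proj₁ (from∘to (i , j₀))))
    (λ i → trans (proj₁ g∈G _ _ refl) (cong proj₁ (to∘from (i , j₀))))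

  colMap : Fin k → Permutation ℓ ℓ
  colMap i = permutation (λ j → proj₂ (from (i , j))) (λ j → proj₂ (to (rowMap ⟨$⟩ʳ i , j)))
    (λ j → trans (cong (λ a → proj₂ (from (a , proj₂ (to (rowMap ⟨$⟩ʳ i , j))))) (row j))
                 (cong proj₂ (from∘to (rowMap ⟨$⟩ʳ i , j))))
    (λ j → trans (cong (λ a → proj₂ (to (a , proj₂ (from (i , j))))) (proj₂ g∈G _ _ refl))
                 (cong proj₂ (to∘from (i , j))))
    where
    row : ∀ j → i ≡ proj₁ (to (rowMap ⟨$⟩ʳ i , j))
    row j = trans (sym (cong proj₁ (to∘from (i , j₀)))) (proj₁ g∈G _ _ refl)

  counts-actS : (S : Sub k ℓ) → counts (actS g S) ≈ counts S
  counts-actS S = permutation⇒≈ (counts S) (counts (actS g S)) rowMap λ i → begin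
    lookup (counts (actS g S)) i      ≡⟨ lookup-map i count (actS g S) ⟩
    count (lookup (actS g S) i)       ≡⟨ cong count (lookup∘tabulate (λ i → tabulate (row i)) i) ⟩
    count (tabulate (row i))          ≡⟨ count-permutation (lookup S (rowMap ⟨$⟩ʳ i)) (tabulate (row i)) (colMap i) (entry i) ⟩
    count (lookup S (rowMap ⟨$⟩ʳ i))  ≡⟨ lookup-map (rowMap ⟨$⟩ʳ i) count S ⟨
    lookup (counts S) (rowMap ⟨$⟩ʳ i) ∎
    where
    open ≡-Reasoning
    row : Fin k → Fin ℓ → Bool
    row i j = memS S (from (i , j))
    entry : ∀ i j → lookup (tabulate (row i)) j ≡ lookup (lookup S (rowMap ⟨$⟩ʳ i)) (colMap i ⟨$⟩ʳ j)
    entry i j = trans (lookup∘tabulate (row i) j)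
      (cong (λ a → lookup (lookup S a) (proj₂ (from (i , j)))) (proj₂ g∈G _ _ refl))

-- A canonical row of size `n`; for `n` beyond `ℓ` it is the full row.
fill : ℕ → Vec Bool ℓ
fill {zero} n = []
fill {suc ℓ} zero = false ∷ fill zero
fill {suc ℓ} (suc n) = true ∷ fill n

count-fill : ∀ {n} → n ≤ ℓ → count (fill {ℓ} n) ≡ n
count-fill {zero} z≤n = refl
count-fill {suc ℓ} {zero} z≤n = count-fill {ℓ} z≤n
count-fill {suc ℓ} {suc n} (s≤s n≤ℓ) = cong suc (count-fill n≤ℓ)

counts-fill : (c : Vec ℕ k) → (∀ i → lookup c i ≤ ℓ) → counts (map (fill {ℓ}) c) ≡ c
counts-fill [] _ = refl
counts-fill (x ∷ c) le = cong₂ _∷_ (count-fill (le zero)) (counts-fill c (le ∘ suc))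

card≡size : (S : Sub k ℓ) → card S ≡ size (counts S)
card≡size [] = refl
card≡size (r ∷ S) = cong (count r +_) (card≡size S)

-- The differential on invariant chains.

xorSum : ∀ {A : Set} → (A → Bool) → List A → Bool
xorSum F = List.foldr (λ x acc → F x xor acc) false

xorSum-++ : ∀ {A : Set} (F : A → Bool) xs ys → xorSum F (xs ++ ys) ≡ xorSum F xs xor xorSum F ys
xorSum-++ F [] ys = refl
xorSum-++ F (x ∷ xs) ys = trans (cong (F x xor_) (xorSum-++ F xs ys)) (sym (xor-assoc (F x) (xorSum F xs) (xorSum F ys)))

xorSum-concatMap : ∀ {A B : Set} (F : B → Bool) (G : A → List B) xs →
  xorSum F (List.concatMap G xs) ≡ xorSum (λ x → xorSum F (G x)) xs
xorSum-concatMap F G [] = refl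
xorSum-concatMap F G (x ∷ xs) = trans (xorSum-++ F (G x) (List.concatMap G xs)) (cong (xorSum F (G x) xor_) (xorSum-concatMap F G xs))

xorSum-tabulate : ∀ {A B : Set} (c : Vec A k) (h : Fin k → B) (F : B → Bool) (χ : A → Bool) →
  (∀ i → F (h i) ≡ χ (lookup c i)) → xorSum F (List.tabulate h) ≡ sumᵇ χ c
xorSum-tabulate [] h F χ e = refl
xorSum-tabulate (x ∷ c) h F χ e = cong₂ _xor_ (e zero) (xorSum-tabulate c (h ∘ suc) F χ (e ∘ suc))

count-insert : (r : Vec Bool ℓ) (j : Fin ℓ) → lookup r j ≡ false → count (updateAt r j (λ _ → true)) ≡ suc (count r)
count-insert (false ∷ r) zero _ = refl
count-insert (true ∷ r) (suc j) e = cong suc (count-insert r j e)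
count-insert (false ∷ r) (suc j) e = count-insert r j e

sumᵇ-complement : ∀ y (r : Vec Bool ℓ) → sumᵇ (λ b → not b ∧ y) r ≡ opp ℓ (count r) ∧ y
sumᵇ-complement y [] = refl
sumᵇ-complement {suc ℓ} y (true ∷ r) = trans (sumᵇ-complement y r) (cong (_∧ y) (sym (xor-annihilates-not (odd (count r)) (odd ℓ))))
sumᵇ-complement {suc ℓ} y (false ∷ r) rewrite sumᵇ-complement y r =
  trans (sym (∧-distribʳ-xor y true (opp ℓ (count r)))) (cong (_∧ y) (not-distribʳ-xor (odd (count r)) (odd ℓ)))

-- Inserting any empty box of a given row leads to the same orbit, so each row contributes its
-- number of empty boxes modulo 2.
Dif≡boundary : (v : Chain k ℓ) (f : Vec ℕ k → Bool) → Symmetric f → (∀ S → v S ≡ f (counts S)) →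
  ∀ T → Dif v T ≡ boundary ℓ f (counts T)
Dif≡boundary {k} {ℓ} v f fs v≡f T =
  trans (xorSum-concatMap F (λ i → List.map (i ,_) (List.allFin ℓ)) (List.allFin k))
        (xorSum-tabulate c (λ i → i) _ (λ x → opp ℓ x ∧ f (incFirst x c)) row)
  where
  open ≡-Reasoning
  c = counts T
  F : Box k ℓ → Bool
  F x = not (memS T x) ∧ v (insertS T x)
  entry : ∀ i j → F (i , j) ≡ not (lookup (lookup T i) j) ∧ f (incFirst (lookup c i) c)
  entry i j with lookup (lookup T i) j in e
  ... | true = refl
  ... | false = begin
    v (insertS T (i , j))          ≡⟨ v≡f _ ⟩
    f (counts (insertS T (i , j))) ≡⟨ cong f (map-updateAt T i (count-insert (lookup T i) j e)) ⟩
    -- The raised entry may be a different occurrence of the same value, which a symmetric `f` does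
    -- not see.
    f (updateAt c i suc)           ≡⟨ fs _ _ (inc-det (updateAt-Inc c i) (incFirst-Inc (lookup c i) c (mult-lookup c i)) (λ _ → refl)) ⟩
    f (incFirst (lookup c i) c)    ∎
  row : ∀ i → xorSum F (List.map (i ,_) (List.allFin ℓ)) ≡ opp ℓ (lookup c i) ∧ f (incFirst (lookup c i) c)
  row i = begin
    xorSum F (List.map (i ,_) (List.allFin ℓ)) ≡⟨ foldr-map (λ x acc → F x xor acc) (i ,_) false (List.allFin ℓ) ⟩
    xorSum (λ j → F (i , j)) (List.allFin ℓ)   ≡⟨ xorSum-tabulate (lookup T i) (λ j → j) (λ j → F (i , j)) (λ b → not b ∧ y) (entry i) ⟩
    sumᵇ (λ b → not b ∧ y) (lookup T i)        ≡⟨ sumᵇ-complement y (lookup T i) ⟩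
    opp ℓ (count (lookup T i)) ∧ y             ≡⟨ cong (λ n → opp ℓ n ∧ y) (lookup-map i count T) ⟨
    opp ℓ (lookup c i) ∧ y                     ∎
    where y = f (incFirst (lookup c i) c)

-- Vanishing of the odd homology.

oddHomologyVanishes : 1 ≤ ℓ → OddHomologyVanishes k ℓ
oddHomologyVanishes {ℓ@(suc _)} {k} _ d d-odd v inv hom cyc = w , w-inv , w-hom , w-bd
  where
  f : Vec ℕ k → Bool
  f c = v (map fill c)
  w : Chain k ℓ
  w S = homotopy ℓ f (counts S)
  f-sym : Symmetric f
  f-sym c c′ e with ≈⇒permutation c c′ e
  ... | π , eq = sym (invariant⇒rows v inv (map fill c) (map fill c′) π λ i → cong count
          (trans (lookup-map i fill c) (trans (cong fill (sym (eq i))) (sym (lookup-map (π ⟨$⟩ʳ i) fill c′)))))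
  bounded : ∀ (S : Sub k ℓ) i → lookup (counts S) i ≤ ℓ
  bounded S i = subst (_≤ ℓ) (sym (lookup-map i count S)) (count≤ (lookup S i))
  v≡f : ∀ S → v S ≡ f (counts S)
  v≡f S = sym (invariant⇒rows v inv S (map fill (counts S)) Perm.id λ i →
    sym (trans (cong count (trans (lookup-map i fill (counts S)) (cong fill (lookup-map i count S)))) (count-fill (count≤ (lookup S i)))))
  f-hom : ∀ c → (∀ i → lookup c i ≤ ℓ) → size c ≢ d → f c ≡ false
  f-hom c le ≢d = hom (map fill c) λ e → ≢d (trans (sym (trans (card≡size (map fill c)) (cong size (counts-fill c le)))) e)
  w-inv : Invariant w
  -- The reference column `zero` exists because `ℓ` is positive.
  w-inv g g∈G S = homotopy-symmetric ℓ f f-sym (counts (actS g S)) (counts S) (counts-actS g g∈G zero S)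
  w-hom : Homog (suc d) w
  w-hom S ≢d with upper? ℓ (counts S)
  ... | no _ = refl
  ... | yes (p , u) = f-hom _ (λ i → ≤-trans (decLast-⊑ p (counts S) i) (bounded S i)) λ e →
          ≢d (trans (card≡size S) (trans (inc-size (upper-Inc ℓ (counts S) u)) (cong suc e)))
  w-bd : ∀ T → Dif w T ≡ v T
  w-bd T = trans (Dif≡boundary w (homotopy ℓ f) (homotopy-symmetric ℓ f f-sym) (λ _ → refl) T)
    (trans (boundary-homotopy ℓ f (counts T) f-sym cycle crit) (sym (v≡f T)))
    where
    -- Below `counts T` all entries are at most `ℓ`, so `c` is realised by a subset, at which the
    -- cycle condition on `v` applies.
    cycle : ∀ c → c ⊑ counts T → boundary ℓ f c ≡ false
    cycle c le = trans (cong (boundary ℓ f) (sym (counts-fill c λ i → ≤-trans (le i) (bounded T i))))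
      (trans (sym (Dif≡boundary v f f-sym v≡f (map fill c))) (cyc (map fill c)))
    crit : (∀ q → bad ℓ (counts T) q ≡ false) → f (counts T) ≡ false
    crit g = f-hom (counts T) (bounded T) λ e →
      true≢false (%2-odd {d} d-odd) (trans (cong odd (sym e)) (critical⇒even ℓ (counts T) g))

theorem4p4 : ∀ (k ℓ : ℕ) → 1 ≤ k → 1 ≤ ℓ →
    IsHasseMatching k ℓ
    × IsAcyclic k ℓ
    × (∀ (la : Vec ℕ k) → IsPart k ℓ la → (Mmatch ℓ la ≡ nothing ⇔ UnmatchedShape ℓ la))
    × OddHomologyVanishes k ℓ
theorem4p4 k ℓ _ 1≤ℓ =
  isHasseMatching ℓ , isAcyclic ℓ , (λ la _ → unmatched⇔shape ℓ la) , oddHomologyVanishes 1≤ℓ
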